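{- For integers $n\ge2$ and $0\le t\le n-2$, the number of $(102,201)$-avoiding inversion sequences $e$ of length $n$ with $\mathrm{rank}(e)=t$ is $$\sum_{m=1}^{n-t-1}a(n,t,m)+\sum_{m=1}^{n-t-3}b(n,t,m),$$ where $$a(n,t,m)=\frac{t+1}{m+t+1}\binom{2m+t}{m}\binom{n-t-2}{m-1}$$ and $$b(n,t,m)=(t+1)\big(2^{n-m-t-2}-1\big)+\sum_{j=1}^{m-1}\sum_{s=0}^{t}\sum_{k=0}^{n-m-t-3}(2^{k+1}-1)\cdot\frac{m+s-j+1}{m+s+1}\binom{m+j+s}{j}\binom{n+j-m-t-k-4}{j-1}.$$ (Sums whose upper limit is less than their lower limit are $0$.)
   Context: An inversion sequence of length $n$ is an integer sequence $e=(e_1,\dots,e_n)$ with $0\le e_j\le j-1$ for all $j$. It contains a pattern $w=w_1w_2w_3$ if there are indices $i_1<i_2<i_3$ such that $e_{i_1}e_{i_2}e_{i_3}$ is order-isomorphic to $w$ (same relations $<,=,>$ between corresponding pairs of entries); otherwise it avoids $w$. "$(w,w')$-avoiding" means avoiding both $w$ and $w'$. $\max(e)$ is the largest entry, and $\mathrm{fdes}(e)$ is the position $p$ of the first descent: $e_1\le\cdots\le e_p>e_{p+1}$, with the convention $e_{n+1}=-1$. For a $102$-avoiding $e$, $\mathrm{rank}(e):=\mathrm{fdes}(e)-\max(e)-1$. -}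

module Defs where

open import Data.Bool using (if_then_else_)
open import Data.Fin as Fin using (Fin; toℕ)
open import Data.Integer as ℤ using (ℤ; +_)
open import Data.List using (List; length; map; upTo; foldr)
open import Data.List.Membership.Propositional using (_∈_)
open import Data.List.Relation.Unary.Unique.Propositional using (Unique)
open import Data.Nat using (ℕ; suc; _+_; _*_; _∸_; _^_; _⊔_; _≤_; _<_; _<ᵇ_)
open import Data.Nat.Combinatorics using (_C_)
open import Data.Product using (_×_; ∃-syntax)
open import Data.Rational as ℚ using (ℚ; 0ℚ)
open import Data.Vec as Vec using (Vec; []; _∷_; lookup)
open import Function.Bundles using (_⇔_)
open import Relation.Binary.PropositionalEquality using (_≡_)
open import Relation.Nullary using (¬_)

private
  variable
    n k : ℕ

-- Indices are 0-based, so e_j ≤ j - 1 becomes lookup e i ≤ toℕ i (i = j - 1).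
IsInversionSequence : Vec ℕ n → Set
IsInversionSequence {n} e = (i : Fin n) → lookup e i ≤ toℕ i

-- The relation > is covered because p and q range over all ordered pairs.
OrderIsomorphic : Vec ℕ k → Vec ℕ k → Set
OrderIsomorphic {k} u v = (p q : Fin k) →
  (lookup u p < lookup u q ⇔ lookup v p < lookup v q) ×
  (lookup u p ≡ lookup u q ⇔ lookup v p ≡ lookup v q)

Contains : Vec ℕ 3 → Vec ℕ n → Set
Contains {n} w e =
  ∃[ i₁ ] ∃[ i₂ ] ∃[ i₃ ]
    i₁ Fin.< i₂ × i₂ Fin.< i₃ ×
    OrderIsomorphic (lookup e i₁ ∷ lookup e i₂ ∷ lookup e i₃ ∷ []) w

Avoids : Vec ℕ 3 → Vec ℕ n → Set
Avoids w e = ¬ Contains w e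

pattern102 pattern201 : Vec ℕ 3
pattern102 = 1 ∷ 0 ∷ 2 ∷ []
pattern201 = 2 ∷ 0 ∷ 1 ∷ []

-- Entries are natural numbers, so 0 is a neutral start value (n ≥ 1).
maxEntry : Vec ℕ n → ℕ
maxEntry = Vec.foldr (λ _ → ℕ) _⊔_ 0

-- The 1-based position of the first descent. A weakly increasing sequence of
-- length n ≥ 1 gets the value n, as prescribed by the convention e_{n+1} = -1.
-- The value at [] is a dummy.
fdes : Vec ℕ n → ℕ
fdes []           = 0
fdes (x ∷ [])     = 1
fdes (x ∷ y ∷ ys) = if y <ᵇ x then 1 else suc (fdes (y ∷ ys))

rank : Vec ℕ n → ℤ
rank e = + fdes e ℤ.- + maxEntry e ℤ.- + 1

AvoiderOfRank : (n t : ℕ) → Vec ℕ n → Set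
AvoiderOfRank n t e =
  IsInversionSequence e ×
  Avoids pattern102 e × Avoids pattern201 e ×
  rank e ≡ + t

-- Exactly N elements of A satisfy P: they can be listed without repetition
-- in a list of length N.
HasCardinality : {A : Set} → (A → Set) → ℕ → Set
HasCardinality {A} P N =
  ∃[ xs ] Unique {A = A} xs × (∀ x → x ∈ xs ⇔ P x) × length xs ≡ N

-- The sum of f i over lo ≤ i ≤ hi; it is 0 when hi < lo.
sumFromTo : (lo hi : ℕ) → (ℕ → ℚ) → ℚ
sumFromTo lo hi f = foldr ℚ._+_ 0ℚ (map (λ i → f (lo + i)) (upTo (suc hi ∸ lo)))

infix 5 sumFromTo
syntax sumFromTo lo hi (λ i → x) = ∑[ lo ≤ i ≤ hi ] x

fromℕ : ℕ → ℚ
fromℕ x = + x ℚ./ 1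

-- In a, b and the sums of their values over m, ∸ agrees with integer subtraction at every index
-- actually summed over (given t ≤ n - 2). The only place it can truncate is
-- the upper limit n - t - 3 = -1, which becomes 0; that sum starts at 1 and is
-- empty either way. Denominators are written suc (m + t) for m + t + 1.
a : (n t m : ℕ) → ℚ
a n t m =
  (+ (t + 1) ℚ./ suc (m + t))
    ℚ.* fromℕ ((2 * m + t) C m)
    ℚ.* fromℕ ((n ∸ t ∸ 2) C (m ∸ 1))

-- The top n + j - m - t - k - 4 of the last binomial is grouped as
-- (n + j) - (m + t + k + 4).
b : (n t m : ℕ) → ℚ
b n t m =
  fromℕ ((t + 1) * (2 ^ (n ∸ m ∸ t ∸ 2) ∸ 1))
    ℚ.+ (∑[ 1 ≤ j ≤ m ∸ 1 ] ∑[ 0 ≤ s ≤ t ] ∑[ 0 ≤ k ≤ n ∸ m ∸ t ∸ 3 ]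
          (fromℕ (2 ^ (k + 1) ∸ 1)
            ℚ.* (+ (m + s ∸ j + 1) ℚ./ suc (m + s))
            ℚ.* fromℕ ((m + j + s) C j)
            ℚ.* fromℕ ((n + j ∸ (m + t + k + 4)) C (j ∸ 1))))

{-# OPTIONS --safe #-}
module Submission where

-- Let p = m + t + 1 be the position of the first descent of an avoider of rank
-- t with maximum m. Avoidance of 102 forces e_p = m, so e is a weakly
-- increasing prefix h of length m + t, then m, then a tail starting below m.
-- If m does not recur, the tail is weakly decreasing; these "plain" avoiders
-- are counted by a(n,t,m), a ballot number times a multiset number. If m recurs
-- and the tail starts with j, then every prefix entry other than m is at most
-- j, and the tail is j, a word in j and m containing m, and a weakly decreasing
-- sequence below j; these "marked" avoiders are counted by b(n,t,m), with s
-- determined by the number m + s of prefix entries different from m, and k + 1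
-- the length of the word. The closed term of b is the contribution of j = 0.
-- Prefixes are stored reversed, so that e is a zipper h ʳ++ (m ∷ tail).

open import Defs
open import Data.Bool using (if_then_else_)
open import Data.Empty using (⊥)
open import Data.Fin as Fin using (Fin; toℕ; zero; suc)
open import Data.Integer as ℤ using () renaming (+_ to pos)
import Data.Integer.Properties as ℤ
open import Data.Integer.Tactic.RingSolver using () renaming (solve-∀ to solveℤ-∀)
open import Data.List using (List; []; _∷_; _++_; _∷ʳ_; _ʳ++_; foldr; length; map; replicate; upTo)
open import Data.List.Membership.Propositional using (_∈_)
open import Data.List.Membership.Propositional.Properties
  using (∈-map⁺; ∈-map⁻; ++-∈⇔; ∈-++⁻; ∈-++⁺ˡ; ∈-upTo⁺; ∈-upTo⁻)
open import Data.List.Properties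
  using (length-map; length-++; length-replicate; length-upTo; length-ʳ++; map-cong; map-upTo;
         map-applyUpTo; map-++; upTo-∷ʳ; ∷-injective)
open import Data.List.Relation.Unary.All as All using (All; []; _∷_)
import Data.List.Relation.Unary.All.Properties as All
open import Data.List.Relation.Unary.AllPairs as AllPairs using (AllPairs; []; _∷_)
open import Data.List.Relation.Unary.Any using (here; there)
open import Data.List.Relation.Unary.Unique.Propositional using (Unique)
import Data.List.Relation.Unary.Unique.Propositional.Properties as Unique
open import Data.Nat hiding (_/_)
open import Data.Nat.Combinatorics using (_C_; nCk+nC[k+1]≡[n+1]C[k+1]; k>n⇒nCk≡0; nCn≡1)
open import Data.Nat.ListAction using (sum)
open import Data.Nat.ListAction.Properties using (sum-++)
open import Data.Nat.Properties
open import Data.List.Membership.DecPropositional _≟_ using (_∈?_)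
open import Data.Nat.Tactic.RingSolver using (solve-∀)
open import Data.Product using (_×_; _,_; ∃-syntax; proj₁; proj₂)
open import Data.Rational as ℚ using (ℚ; 0ℚ)
import Data.Rational.Properties as ℚ
open import Data.Rational.Unnormalised as ℚᵘ using (mkℚᵘ; *≡*)
import Data.Rational.Unnormalised.Properties as ℚᵘ
open import Data.Sum using (_⊎_; inj₁; inj₂; [_,_]′)
open import Data.Unit using (⊤; tt)
open import Data.Vec as Vec using (Vec; []; _∷_; lookup; fromList)
open import Function.Base using (_∘_; id; case_of_)
open import Function.Bundles using (_⇔_; mk⇔; module Equivalence)
open import Relation.Binary.Definitions using (tri<; tri≈; tri>)
open import Relation.Binary.PropositionalEquality
open import Relation.Nullary using (¬_; Dec; yes; no; does; contradiction)
open import Relation.Nullary.Decidable using (dec-true; dec-false)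
open Equivalence using (to; from)

private
  variable
    A B : Set
    P Q : A → Set
    M N n : ℕ

-- Cardinalities

card-⇔ : (∀ x → P x ⇔ Q x) → HasCardinality P N → HasCardinality Q N
card-⇔ P⇔Q (xs , unique , complete , size) =
  xs , unique , (λ x → mk⇔ (to (P⇔Q x) ∘ to (complete x)) (from (complete x) ∘ from (P⇔Q x))) , size

card-∅ : (∀ x → ¬ P x) → HasCardinality P 0
card-∅ empty = [] , [] , (λ x → mk⇔ (λ ()) (λ Px → contradiction Px (empty x))) , refl

card-singleton : ∀ a → (∀ x → x ≡ a ⇔ P x) → HasCardinality P 1
card-singleton a a⇔P = a ∷ [] , [] ∷ [] ,
  (λ x → mk⇔ (λ { (here x≡a) → to (a⇔P x) x≡a ; (there ()) }) (here ∘ from (a⇔P x))) , refl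

card-⊎ : (∀ x → P x → Q x → ⊥) → HasCardinality P M → HasCardinality Q N →
         HasCardinality (λ x → P x ⊎ Q x) (M + N)
card-⊎ {P = P} {Q} disjoint (xs , uxs , cxs , refl) (ys , uys , cys , refl) =
  xs ++ ys ,
  Unique.++⁺ uxs uys (λ { (x∈xs , x∈ys) → disjoint _ (to (cxs _) x∈xs) (to (cys _) x∈ys) }) ,
  (λ x → mk⇔ (λ x∈ → case to ++-∈⇔ x∈ of λ
                { (inj₁ x∈xs) → inj₁ (to (cxs x) x∈xs)
                ; (inj₂ x∈ys) → inj₂ (to (cys x) x∈ys) })
             λ { (inj₁ Px) → from ++-∈⇔ (inj₁ (from (cxs x) Px))
               ; (inj₂ Qx) → from ++-∈⇔ (inj₂ (from (cys x) Qx)) }) ,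
  length-++ xs

unique-map : (f : A → B) {xs : List A} →
             (∀ {x y} → x ∈ xs → y ∈ xs → f x ≡ f y → x ≡ y) →
             Unique xs → Unique (map f xs)
unique-map f injective [] = []
unique-map f {x ∷ xs} injective (x∉xs ∷ unique) =
  All.tabulate (λ y∈ fx≡y → case ∈-map⁻ f y∈ of λ
    { (z , z∈xs , refl) → All.lookup x∉xs z∈xs (injective (here refl) (there z∈xs) fx≡y) }) ∷
  unique-map f (λ x∈ y∈ → injective (there x∈) (there y∈)) unique

-- Injectivity is asked only between elements satisfying `P`: the gluing maps `plain` and `marked t`
-- forget where the pieces were joined, and only valid data can be read back.
card-image : (f : A → B) → (∀ {x y} → P x → P y → f x ≡ f y → x ≡ y) →
             HasCardinality P N → HasCardinality (λ y → ∃[ x ] P x × y ≡ f x) N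
card-image f injective (xs , unique , complete , refl) =
  map f xs ,
  unique-map f (λ x∈ y∈ → injective (to (complete _) x∈) (to (complete _) y∈)) unique ,
  (λ y → mk⇔ (λ y∈ → case ∈-map⁻ f y∈ of λ { (x , x∈xs , y≡fx) → x , to (complete x) x∈xs , y≡fx })
             (λ { (x , Px , refl) → ∈-map⁺ f (from (complete x) Px) })) ,
  length-map f xs

card-Σ : {Q : A → B → Set} {size : A → ℕ} {xs : List A} → Unique xs →
         (∀ {x} → x ∈ xs → HasCardinality (Q x) (size x)) →
         HasCardinality (λ (x , y) → x ∈ xs × Q x y) (sum (map size xs))
card-Σ [] fibre = card-∅ λ { _ (() , _) }
card-Σ {Q = Q} {xs = x ∷ xs} (x∉xs ∷ unique) fibre = card-⇔
  (λ (a , b) → mk⇔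
    (λ { (inj₁ (_ , Qxb , refl)) → here refl , Qxb
       ; (inj₂ (a∈xs , Qab)) → there a∈xs , Qab })
    (λ { (here refl , Qxb) → inj₁ (b , Qxb , refl)
       ; (there a∈xs , Qab) → inj₂ (a∈xs , Qab) }))
  (card-⊎ (λ { _ (_ , _ , refl) (x∈xs , _) → All.lookup x∉xs x∈xs refl })
    (card-image (x ,_) (λ { _ _ refl → refl }) (fibre (here refl)))
    (card-Σ unique (fibre ∘ there)))

sum-map-const : ∀ c (xs : List A) → sum (map (λ _ → c) xs) ≡ length xs * c
sum-map-const c []       = refl
sum-map-const c (x ∷ xs) = cong (c +_) (sum-map-const c xs)

card-× : HasCardinality P M → HasCardinality Q N →
         HasCardinality (λ (x , y) → P x × Q y) (M * N)
card-× {N = N} (xs , unique , complete , refl) cardQ =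
  subst (HasCardinality _) (sum-map-const N xs) (card-⇔
    (λ (x , y) → mk⇔ (λ (x∈ , Qy) → to (complete x) x∈ , Qy)
                     (λ (Px , Qy) → from (complete x) Px , Qy))
    (card-Σ unique (λ _ → cardQ)))

∑ℕ : (lo hi : ℕ) → (ℕ → ℕ) → ℕ
∑ℕ lo hi f = sum (map (λ i → f (lo + i)) (upTo (suc hi ∸ lo)))

<∸⇒+≤ : ∀ {i m} lo → i < suc m ∸ lo → lo + i ≤ m
<∸⇒+≤             zero     (s≤s i≤m) = i≤m
<∸⇒+≤ {i} {suc m} (suc lo) i<        = s≤s (<∸⇒+≤ lo i<)
<∸⇒+≤ {i} {zero}  (suc lo) i<        = case subst (i <_) (0∸n≡0 lo) i< of λ ()

+≤⇒<∸ : ∀ {i m} lo → lo + i ≤ m → i < suc m ∸ lo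
+≤⇒<∸ zero     i≤m       = s≤s i≤m
+≤⇒<∸ (suc lo) (s≤s i≤m) = +≤⇒<∸ lo i≤m

-- The fibre hypothesis receives the bounds on the index because some fibres have the stated size
-- only inside the range, such as the words over `j` and `m`, which need `j < m`.
card-∑ : ∀ lo hi {Q : ℕ → B → Set} {size : ℕ → ℕ} →
         (∀ {i} → lo ≤ i → i ≤ hi → HasCardinality (Q i) (size i)) →
         HasCardinality (λ (i , y) → (lo ≤ i × i ≤ hi) × Q i y) (∑ℕ lo hi size)
card-∑ lo hi {Q} fibre = card-⇔
  (λ (i , y) → mk⇔
    (λ { ((j , y) , (j∈ , Qy) , refl) → (m≤m+n lo j , <∸⇒+≤ lo (∈-upTo⁻ j∈)) , Qy })
    (λ ((lo≤i , i≤hi) , Qy) → let lo+≡ = m+[n∸m]≡n lo≤i in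
      (i ∸ lo , y) ,
      (∈-upTo⁺ (+≤⇒<∸ lo (subst (_≤ hi) (sym lo+≡) i≤hi)) , subst (λ k → Q k y) (sym lo+≡) Qy) ,
      cong (_, y) (sym lo+≡)))
  (card-image (λ (j , y) → lo + j , y)
    (λ _ _ eq → cong₂ _,_ (+-cancelˡ-≡ lo _ _ (cong proj₁ eq)) (cong proj₂ eq))
    (card-Σ (Unique.upTo⁺ (suc hi ∸ lo)) (λ j∈ → fibre (m≤m+n lo _) (<∸⇒+≤ lo (∈-upTo⁻ j∈)))))

-- Read from the right, a list is Descending P u when it is weakly increasing
-- with entries below u and every entry is P-related to its 0-based position.
data Descending (P : ℕ → ℕ → Set) (u : ℕ) : List ℕ → Set where
  []  : Descending P u []
  _∷_ : ∀ {x xs} → x < u × P x (length xs) → Descending P (suc x) xs → Descending P u (x ∷ xs)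

-- A Pascal-type recursion on the head, which is the largest entry: either it is below `u`, or it
-- equals `u`, which is admissible only if `P u l` holds at its position `l`.
descendings : {P : ℕ → ℕ → Set} → (∀ x l → Dec (P x l)) → (u l : ℕ) → ℕ
descendings P? u       zero    = 1
descendings P? zero    (suc l) = 0
descendings P? (suc u) (suc l) =
  descendings P? u (suc l) + (if does (P? u l) then descendings P? (suc u) l else 0)

module _ {P : ℕ → ℕ → Set} where

  weaken : ∀ {u v xs} → u ≤ v → Descending P u xs → Descending P v xs
  weaken u≤v []                  = []
  weaken u≤v ((x<u , Px) ∷ desc) = (<-≤-trans x<u u≤v , Px) ∷ desc

  -- Only the head is compared with the bound; every later entry is bounded by its neighbour.
  tighten : ∀ {u v xs} → All (_< v) xs → Descending P u xs → Descending P v xs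
  tighten []        []              = []
  tighten (x<v ∷ _) ((_ , Px) ∷ desc) = (x<v , Px) ∷ desc

  descending-< : ∀ {u xs} → Descending P u xs → All (_< u) xs
  descending-< []                 = []
  descending-< ((x<u , _) ∷ desc) = x<u ∷ All.map (λ y≤x → <-≤-trans y≤x x<u) (descending-< desc)

  card-descending : (P? : ∀ x l → Dec (P x l)) → ∀ u l →
    HasCardinality (λ xs → length xs ≡ l × Descending P u xs) (descendings P? u l)
  card-descending P? u zero =
    card-singleton [] (λ { [] → mk⇔ (λ _ → refl , []) (λ _ → refl) ; (_ ∷ _) → mk⇔ (λ ()) (λ ()) })
  card-descending P? zero (suc l) = card-∅ λ { (_ ∷ _) (_ , (() , _) ∷ _) }
  card-descending P? (suc u) (suc l) = card-⇔
    (λ xs → mk⇔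
      (λ { (inj₁ (eq , desc)) → eq , weaken (n≤1+n u) desc
         ; (inj₂ (ys , (Pul , refl , desc) , refl)) → refl , (≤-refl , Pul) ∷ desc })
      (λ { (eq , desc) → split eq desc }))
    (card-⊎ disjoint (card-descending P? u (suc l)) (card-image (u ∷_) (λ { _ _ refl → refl }) first))
    where
    Top : List ℕ → Set
    Top ys = P u l × length ys ≡ l × Descending P (suc u) ys

    split : ∀ {xs} → length xs ≡ suc l → Descending P (suc u) xs →
            (length xs ≡ suc l × Descending P u xs) ⊎ ∃[ ys ] Top ys × xs ≡ u ∷ ys
    split {x ∷ ys} refl ((s≤s x≤u , Px) ∷ desc) with m≤n⇒m<n∨m≡n x≤u
    ... | inj₁ x<u  = inj₁ (refl , (x<u , Px) ∷ desc)
    ... | inj₂ refl = inj₂ (ys , (Px , refl , desc) , refl)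

    disjoint : ∀ xs → length xs ≡ suc l × Descending P u xs → (∃[ ys ] Top ys × xs ≡ u ∷ ys) → ⊥
    disjoint _ (_ , (u<u , _) ∷ _) (_ , _ , refl) = <-irrefl refl u<u

    first : HasCardinality Top (if does (P? u l) then descendings P? (suc u) l else 0)
    first with P? u l
    ... | yes Pul = card-⇔ (λ _ → mk⇔ (Pul ,_) proj₂) (card-descending P? (suc u) l)
    ... | no ¬Pul = card-∅ (λ _ (Pul , _) → ¬Pul Pul)

-- Words over two letters

Letter : (j m x : ℕ) → Set
Letter j m x = x ≡ j ⊎ x ≡ m

module _ {j m : ℕ} (j<m : j < m) where

  card-words : ∀ l → HasCardinality (λ w → length w ≡ l × All (Letter j m) w) (2 ^ l)
  card-words zero =
    card-singleton [] (λ { [] → mk⇔ (λ _ → refl , []) (λ _ → refl) ; (_ ∷ _) → mk⇔ (λ ()) (λ ()) })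
  card-words (suc l) = subst (HasCardinality _) (cong (2 ^ l +_) (sym (+-identityʳ (2 ^ l)))) (card-⇔
    (λ _ → mk⇔
      (λ { (inj₁ (w , (refl , letters) , refl)) → refl , inj₁ refl ∷ letters
         ; (inj₂ (w , (refl , letters) , refl)) → refl , inj₂ refl ∷ letters })
      (λ { (eq , inj₁ refl ∷ letters) → inj₁ (_ , (suc-injective eq , letters) , refl)
         ; (eq , inj₂ refl ∷ letters) → inj₂ (_ , (suc-injective eq , letters) , refl) }))
    (card-⊎ (λ { _ (_ , _ , refl) (_ , _ , refl) → <-irrefl refl j<m })
      (card-image (j ∷_) (λ { _ _ refl → refl }) (card-words l))
      (card-image (m ∷_) (λ { _ _ refl → refl }) (card-words l))))

  -- After a first letter `m` the rest is arbitrary, after `j` it must still contain `m`; in total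
  -- only the constant word in `j` is lost.
  card-words-∋ : ∀ l →
    HasCardinality (λ w → length w ≡ l × All (Letter j m) w × m ∈ w) (2 ^ l ∸ 1)
  card-words-∋ zero = card-∅ λ { [] (_ , _ , ()) }
  card-words-∋ (suc l) = subst (HasCardinality _) size (card-⇔
    (λ _ → mk⇔
      (λ { (inj₁ (w , (refl , letters) , refl)) → refl , inj₂ refl ∷ letters , here refl
         ; (inj₂ (w , (refl , letters , m∈w) , refl)) → refl , inj₁ refl ∷ letters , there m∈w })
      (λ { (eq , inj₂ refl ∷ letters , _) → inj₁ (_ , (suc-injective eq , letters) , refl)
         ; (eq , inj₁ refl ∷ letters , there m∈w) → inj₂ (_ , (suc-injective eq , letters , m∈w) , refl)
         ; (eq , inj₁ refl ∷ letters , here m≡j) → contradiction j<m (<-irrefl (sym m≡j)) }))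
    (card-⊎ (λ { _ (_ , _ , refl) (_ , _ , refl) → <-irrefl refl j<m })
      (card-image (m ∷_) (λ { _ _ refl → refl }) (card-words l))
      (card-image (j ∷_) (λ { _ _ refl → refl }) (card-words-∋ l))))
    where
    size : 2 ^ l + (2 ^ l ∸ 1) ≡ 2 ^ suc l ∸ 1
    size = trans (sym (+-∸-assoc (2 ^ l) (m^n>0 2 l)))
                 (cong (λ p → 2 ^ l + p ∸ 1) (sym (+-identityʳ (2 ^ l))))

-- Closed formulas

weaklyDecreasings prefixes : (u l : ℕ) → ℕ
weaklyDecreasings = descendings (λ _ _ → yes tt)
prefixes          = descendings _≤?_

-- These sequences are multisets of size `l` drawn from `v + 1` values, and the recursion of
-- `descendings` is Pascal's rule.
weaklyDecreasings-closed : ∀ v l → weaklyDecreasings (suc v) l ≡ (v + l) C v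
weaklyDecreasings-closed zero    zero    = refl
weaklyDecreasings-closed (suc v) zero    =
  sym (trans (cong (_C suc v) (+-identityʳ (suc v))) (nCn≡1 (suc v)))
weaklyDecreasings-closed zero    (suc l) = weaklyDecreasings-closed zero l
weaklyDecreasings-closed (suc v) (suc l) = begin
  weaklyDecreasings (suc v) (suc l) + weaklyDecreasings (suc (suc v)) l
    ≡⟨ cong₂ _+_ (weaklyDecreasings-closed v (suc l)) (weaklyDecreasings-closed (suc v) l) ⟩
  (v + suc l) C v + (suc v + l) C suc v
    ≡⟨ cong (λ n → (v + suc l) C v + n C suc v) (sym (+-suc v l)) ⟩
  (v + suc l) C v + (v + suc l) C suc v
    ≡⟨ nCk+nC[k+1]≡[n+1]C[k+1] (v + suc l) v ⟩
  (suc v + suc l) C suc v ∎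
  where open ≡-Reasoning

[k+1]*[n+1]C[k+1]≡[n+1]*nCk : ∀ n k → suc k * (suc n C suc k) ≡ suc n * (n C k)
[k+1]*[n+1]C[k+1]≡[n+1]*nCk zero    zero    = refl
[k+1]*[n+1]C[k+1]≡[n+1]*nCk zero    (suc k) = begin
  suc (suc k) * (1 C suc (suc k)) ≡⟨ cong (suc (suc k) *_) (k>n⇒nCk≡0 {1} {suc (suc k)} (s≤s (s≤s z≤n))) ⟩
  suc (suc k) * 0                 ≡⟨ *-zeroʳ (suc (suc k)) ⟩
  0                               ≡⟨ sym (cong (1 *_) (k>n⇒nCk≡0 {0} {suc k} (s≤s z≤n))) ⟩
  1 * (0 C suc k)                 ∎
  where open ≡-Reasoning
[k+1]*[n+1]C[k+1]≡[n+1]*nCk (suc n) zero    = begin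
  1 * (suc (suc n) C 1)          ≡⟨ cong (1 *_) (sym (nCk+nC[k+1]≡[n+1]C[k+1] (suc n) 0)) ⟩
  1 * (1 + suc n C 1)            ≡⟨ *-distribˡ-+ 1 1 (suc n C 1) ⟩
  1 + 1 * (suc n C 1)            ≡⟨ cong suc ([k+1]*[n+1]C[k+1]≡[n+1]*nCk n 0) ⟩
  1 + suc n * 1                  ∎
  where open ≡-Reasoning
[k+1]*[n+1]C[k+1]≡[n+1]*nCk (suc n) (suc k) = begin
  suc (suc k) * (suc (suc n) C suc (suc k))
    ≡⟨ cong (suc (suc k) *_) (sym (nCk+nC[k+1]≡[n+1]C[k+1] (suc n) (suc k))) ⟩
  suc (suc k) * (suc n C suc k + suc n C suc (suc k))
    ≡⟨ *-distribˡ-+ (suc (suc k)) (suc n C suc k) _ ⟩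
  suc n C suc k + suc k * (suc n C suc k) + suc (suc k) * (suc n C suc (suc k))
    ≡⟨ cong₂ (λ p q → suc n C suc k + p + q)
         ([k+1]*[n+1]C[k+1]≡[n+1]*nCk n k) ([k+1]*[n+1]C[k+1]≡[n+1]*nCk n (suc k)) ⟩
  suc n C suc k + suc n * (n C k) + suc n * (n C suc k)
    ≡⟨ trans (+-assoc (suc n C suc k) _ _) (cong (λ p → suc n C suc k + p) (sym (*-distribˡ-+ (suc n) (n C k) (n C suc k)))) ⟩
  suc n C suc k + suc n * (n C k + n C suc k)
    ≡⟨ cong (λ p → suc n C suc k + suc n * p) (nCk+nC[k+1]≡[n+1]C[k+1] n k) ⟩
  suc (suc n) * (suc n C suc k) ∎
  where open ≡-Reasoning

-- The ratio of neighbouring binomials in one row, from comparing Pascal's rule with the absorption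
-- identity above.
[k+1]*nC[k+1]≡l*nCk : ∀ k l → suc k * ((k + l) C suc k) ≡ l * ((k + l) C k)
[k+1]*nC[k+1]≡l*nCk k l = +-cancelˡ-≡ (suc k * X) _ _ (begin
  suc k * X + suc k * Y         ≡⟨ sym (*-distribˡ-+ (suc k) X Y) ⟩
  suc k * (X + Y)               ≡⟨ cong (suc k *_) (nCk+nC[k+1]≡[n+1]C[k+1] (k + l) k) ⟩
  suc k * (suc (k + l) C suc k) ≡⟨ [k+1]*[n+1]C[k+1]≡[n+1]*nCk (k + l) k ⟩
  suc (k + l) * X               ≡⟨ *-distribʳ-+ X (suc k) l ⟩
  suc k * X + l * X             ∎)
  where
  open ≡-Reasoning
  X = (k + l) C k
  Y = (k + l) C suc k

prefixes-1 : ∀ l → prefixes 1 l ≡ 1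
prefixes-1 zero    = refl
prefixes-1 (suc l) = prefixes-1 l

-- The arithmetic of the ballot induction. The key is `X + g₂ ≡ Y`: the ballot number `g₂` is a
-- difference of neighbouring binomials, as in the reflection principle. It absorbs the extra `g₂`
-- that arises because the two hypotheses have different denominators.
ballot-step : ∀ v w g₁ g₂ X Y → suc v * Y ≡ suc (v + w) * X →
              suc (suc (v + w)) * g₁ ≡ suc (suc w) * X → suc (v + w) * g₂ ≡ w * Y →
              suc (suc (v + w)) * (g₁ + g₂) ≡ suc w * (X + Y)
ballot-step v w g₁ g₂ X Y absorb eq₁ eq₂ = begin
  suc (suc (v + w)) * (g₁ + g₂)                     ≡⟨ *-distribˡ-+ (suc (suc (v + w))) g₁ g₂ ⟩
  suc (suc (v + w)) * g₁ + (g₂ + suc (v + w) * g₂)  ≡⟨ cong₂ (λ p q → p + (g₂ + q)) eq₁ eq₂ ⟩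
  suc (suc w) * X + (g₂ + w * Y)                    ≡⟨ regroup w X g₂ Y ⟩
  suc w * X + ((X + g₂) + w * Y)                    ≡⟨ cong (λ p → suc w * X + (p + w * Y)) X+g₂≡Y ⟩
  suc w * X + suc w * Y                             ≡⟨ sym (*-distribˡ-+ (suc w) X Y) ⟩
  suc w * (X + Y)                                   ∎
  where
  open ≡-Reasoning
  regroup : ∀ w X g Y → suc (suc w) * X + (g + w * Y) ≡ suc w * X + ((X + g) + w * Y)
  regroup = solve-∀
  factor : ∀ v w Y → suc v * Y + w * Y ≡ suc (v + w) * Y
  factor = solve-∀
  X+g₂≡Y : X + g₂ ≡ Y
  X+g₂≡Y = *-cancelˡ-≡ _ _ (suc (v + w)) (begin
    suc (v + w) * (X + g₂)               ≡⟨ *-distribˡ-+ (suc (v + w)) X g₂ ⟩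
    suc (v + w) * X + suc (v + w) * g₂   ≡⟨ cong₂ _+_ (sym absorb) eq₂ ⟩
    suc v * Y + w * Y                    ≡⟨ factor v w Y ⟩
    suc (v + w) * Y                      ∎)

-- The second summand in the recursion for `prefixes (suc (suc v)) (suc (v + w))`: the prefixes
-- whose largest entry is `suc v`. It vanishes for `w = 0`, where that entry would exceed its
-- position.
topPrefixes : (v w : ℕ) → ℕ
topPrefixes v w = if does (suc v ≤? v + w) then prefixes (suc (suc v)) (v + w) else 0

prefixes-step : ∀ v w →
  suc (suc (v + w)) * prefixes (suc v) (suc (v + w)) ≡ suc (suc w) * ((v + suc (v + w)) C v) →
  suc (v + w) * topPrefixes v w ≡ w * ((v + suc (v + w)) C suc v) →
  suc (suc v + w) * prefixes (suc (suc v)) (suc v + w) ≡ suc w * ((suc v + (suc v + w)) C suc v)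
prefixes-step v w eq₁ eq₂ = begin
  suc (suc (v + w)) * (prefixes (suc v) (suc (v + w)) + topPrefixes v w)
    ≡⟨ ballot-step v w (prefixes (suc v) (suc (v + w))) (topPrefixes v w) X Y
         ([k+1]*nC[k+1]≡l*nCk v (suc (v + w))) eq₁ eq₂ ⟩
  suc w * (X + Y)
    ≡⟨ cong (suc w *_) (nCk+nC[k+1]≡[n+1]C[k+1] (v + suc (v + w)) v) ⟩
  suc w * ((suc v + suc (v + w)) C suc v) ∎
  where
  open ≡-Reasoning
  X = (v + suc (v + w)) C v
  Y = (v + suc (v + w)) C suc v

-- The ballot number of lattice paths that stay on one side of the diagonal, with `w` the slack
-- between the length and the largest allowed entry. It is multiplied out to stay in the naturals,
-- and `l` is kept apart from `v + w` so that both recursive calls fit up to an equation.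
prefixes-closed : ∀ v w {l} → l ≡ v + w → suc l * prefixes (suc v) l ≡ suc w * ((v + l) C v)
prefixes-closed zero    w       refl = cong (suc w *_) (prefixes-1 w)
prefixes-closed (suc v) zero    refl =
  prefixes-step v 0 (prefixes-closed v 1 (sym (+-suc v 0))) topPrefixes≡0
  where
  topPrefixes≡0 : suc (v + 0) * topPrefixes v 0 ≡ 0
  topPrefixes≡0 rewrite +-identityʳ v | dec-false (suc v ≤? v) (<-irrefl refl) = *-zeroʳ (suc v)
prefixes-closed (suc v) (suc w) refl =
  prefixes-step v (suc w) (prefixes-closed v (suc (suc w)) (sym (+-suc v (suc w)))) (begin
    suc (v + suc w) * topPrefixes v (suc w)
      ≡⟨ cong (λ b → suc (v + suc w) * (if b then prefixes (suc (suc v)) (v + suc w) else 0))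
           (dec-true (suc v ≤? v + suc w) (m<m+n v z<s)) ⟩
    suc (v + suc w) * prefixes (suc (suc v)) (v + suc w)
      ≡⟨ prefixes-closed (suc v) w (+-suc v w) ⟩
    suc w * ((suc v + (v + suc w)) C suc v)
      ≡⟨ cong (λ n → suc w * (n C suc v)) (sym (+-suc v (v + suc w))) ⟩
    suc w * ((v + suc (v + suc w)) C suc v) ∎)
  where open ≡-Reasoning

-- Passage to the rationals

fromℚᵘ-homo-+ : ∀ p q → ℚ.fromℚᵘ (p ℚᵘ.+ q) ≡ ℚ.fromℚᵘ p ℚ.+ ℚ.fromℚᵘ q
fromℚᵘ-homo-+ p q = ℚ.toℚᵘ-injective (begin
  ℚ.toℚᵘ (ℚ.fromℚᵘ (p ℚᵘ.+ q))                       ≈⟨ ℚ.toℚᵘ-fromℚᵘ (p ℚᵘ.+ q) ⟩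
  p ℚᵘ.+ q                                           ≈⟨ ℚᵘ.+-cong (ℚ.toℚᵘ-fromℚᵘ p) (ℚ.toℚᵘ-fromℚᵘ q) ⟨
  ℚ.toℚᵘ (ℚ.fromℚᵘ p) ℚᵘ.+ ℚ.toℚᵘ (ℚ.fromℚᵘ q)       ≈⟨ ℚ.toℚᵘ-homo-+ (ℚ.fromℚᵘ p) (ℚ.fromℚᵘ q) ⟨
  ℚ.toℚᵘ (ℚ.fromℚᵘ p ℚ.+ ℚ.fromℚᵘ q)                 ∎)
  where open import Relation.Binary.Reasoning.Setoid ℚᵘ.≃-setoid

fromℚᵘ-homo-* : ∀ p q → ℚ.fromℚᵘ (p ℚᵘ.* q) ≡ ℚ.fromℚᵘ p ℚ.* ℚ.fromℚᵘ q
fromℚᵘ-homo-* p q = ℚ.toℚᵘ-injective (begin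
  ℚ.toℚᵘ (ℚ.fromℚᵘ (p ℚᵘ.* q))                       ≈⟨ ℚ.toℚᵘ-fromℚᵘ (p ℚᵘ.* q) ⟩
  p ℚᵘ.* q                                           ≈⟨ ℚᵘ.*-cong (ℚ.toℚᵘ-fromℚᵘ p) (ℚ.toℚᵘ-fromℚᵘ q) ⟨
  ℚ.toℚᵘ (ℚ.fromℚᵘ p) ℚᵘ.* ℚ.toℚᵘ (ℚ.fromℚᵘ q)       ≈⟨ ℚ.toℚᵘ-homo-* (ℚ.fromℚᵘ p) (ℚ.fromℚᵘ q) ⟨
  ℚ.toℚᵘ (ℚ.fromℚᵘ p ℚ.* ℚ.fromℚᵘ q)                 ∎)
  where open import Relation.Binary.Reasoning.Setoid ℚᵘ.≃-setoid

fromℕ-+ : ∀ m n → fromℕ (m + n) ≡ fromℕ m ℚ.+ fromℕ n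
fromℕ-+ m n = trans
  -- Unnormalised addition cross-multiplies, so the numerators acquire factors 1.
  (cong (ℚ._/ 1) (cong₂ ℤ._+_ (sym (ℤ.*-identityʳ (pos m))) (sym (ℤ.*-identityʳ (pos n)))))
  (fromℚᵘ-homo-+ (mkℚᵘ (pos m) 0) (mkℚᵘ (pos n) 0))

fromℕ-* : ∀ m n → fromℕ (m * n) ≡ fromℕ m ℚ.* fromℕ n
fromℕ-* m n = trans (cong (ℚ._/ 1) (ℤ.pos-* m n)) (fromℚᵘ-homo-* (mkℚᵘ (pos m) 0) (mkℚᵘ (pos n) 0))

-- Carries the multiplied-out ballot identity over to the fractions in `a` and `b`.
/-*-fromℕ : ∀ p d c g → suc d * g ≡ p * c → (pos p ℚ./ suc d) ℚ.* fromℕ c ≡ fromℕ g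
/-*-fromℕ p d c g eq = trans
  (sym (fromℚᵘ-homo-* (mkℚᵘ (pos p) d) (mkℚᵘ (pos c) 0)))
  (ℚ.fromℚᵘ-cong {mkℚᵘ (pos p) d ℚᵘ.* mkℚᵘ (pos c) 0} {mkℚᵘ (pos g) 0} (*≡* (begin
    pos p ℤ.* pos c ℤ.* pos 1  ≡⟨ ℤ.*-identityʳ _ ⟩
    pos p ℤ.* pos c            ≡⟨ sym (ℤ.pos-* p c) ⟩
    pos (p * c)                ≡⟨ cong pos (trans (sym eq) (*-comm (suc d) g)) ⟩
    pos (g * suc d)            ≡⟨ cong (λ k → pos (g * k)) (sym (*-identityʳ (suc d))) ⟩
    pos (g * (suc d * 1))      ≡⟨ ℤ.pos-* g (suc d * 1) ⟩
    pos g ℤ.* pos (suc d * 1)  ∎)))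
  where open ≡-Reasoning

fromℕ-∑ : ∀ lo hi {f : ℕ → ℕ} {g : ℕ → ℚ} →
          (∀ {i} → lo ≤ i → i ≤ hi → fromℕ (f i) ≡ g i) → fromℕ (∑ℕ lo hi f) ≡ sumFromTo lo hi g
fromℕ-∑ lo hi {f} {g} f≡g = go (upTo (suc hi ∸ lo)) λ j∈ → f≡g (m≤m+n lo _) (<∸⇒+≤ lo (∈-upTo⁻ j∈))
  where
  go : ∀ is → (∀ {i} → i ∈ is → fromℕ (f (lo + i)) ≡ g (lo + i)) →
       fromℕ (sum (map (λ i → f (lo + i)) is)) ≡ foldr ℚ._+_ 0ℚ (map (λ i → g (lo + i)) is)
  go []       eq = refl
  go (i ∷ is) eq = trans (fromℕ-+ (f (lo + i)) _) (cong₂ ℚ._+_ (eq (here refl)) (go is (eq ∘ there)))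

∑ℕ-const : ∀ hi c → ∑ℕ 0 hi (λ _ → c) ≡ suc hi * c
∑ℕ-const hi c = trans (sum-map-const c (upTo (suc hi))) (cong (_* c) (length-upTo (suc hi)))

-- Used to separate `j = 0`, which gives the closed term of `b`, from the triple sum.
∑ℕ-first : ∀ hi f → ∑ℕ 0 hi f ≡ f 0 + ∑ℕ 1 hi f
∑ℕ-first hi f = cong (λ xs → f 0 + sum xs) (trans (map-applyUpTo suc f hi) (sym (map-upTo (f ∘ suc) hi)))

∑ℕ-last : ∀ hi f → (∀ {i} → i < hi → f i ≡ 0) → ∑ℕ 0 hi f ≡ f hi
∑ℕ-last hi f f≡0 = begin
  sum (map f (upTo (suc hi)))      ≡⟨ cong (sum ∘ map f) (sym (upTo-∷ʳ hi)) ⟩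
  sum (map f (upTo hi ∷ʳ hi))      ≡⟨ cong sum (map-++ f (upTo hi) (hi ∷ [])) ⟩
  sum (map f (upTo hi) ∷ʳ f hi)    ≡⟨ sum-++ (map f (upTo hi)) (f hi ∷ []) ⟩
  sum (map f (upTo hi)) + (f hi + 0)
    ≡⟨ cong₂ _+_ (zeros (upTo hi) (f≡0 ∘ ∈-upTo⁻)) (+-identityʳ (f hi)) ⟩
  f hi                             ∎
  where
  open ≡-Reasoning
  zeros : ∀ is → (∀ {i} → i ∈ is → f i ≡ 0) → sum (map f is) ≡ 0
  zeros []       eq = refl
  zeros (i ∷ is) eq = cong₂ _+_ (eq (here refl)) (zeros is (eq ∘ there))

-- Pattern avoidance on lists

-- A valley at y between x and z is not a 102 or a 201 exactly when z returns to x.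
Returns : (x y z : ℕ) → Set
Returns x y z = y < x → y < z → z ≡ x

data Good : List ℕ → Set where
  []  : Good []
  _∷_ : ∀ {x xs} → AllPairs (Returns x) xs → Good xs → Good (x ∷ xs)

SameOrder : (a b c d : ℕ) → Set
SameOrder a b c d = (a < b ⇔ c < d) × (a ≡ b ⇔ c ≡ d)

same-< : ∀ {a b c d} → a < b → c < d → SameOrder a b c d
same-< a<b c<d = mk⇔ (λ _ → c<d) (λ _ → a<b) ,
  mk⇔ (λ a≡b → contradiction a<b (<-irrefl a≡b)) (λ c≡d → contradiction c<d (<-irrefl c≡d))

same-> : ∀ {a b c d} → b < a → d < c → SameOrder a b c d
same-> b<a d<c = mk⇔ (λ a<b → contradiction a<b (<-asym b<a)) (λ c<d → contradiction c<d (<-asym d<c)) ,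
  mk⇔ (λ a≡b → contradiction b<a (<-irrefl (sym a≡b))) (λ c≡d → contradiction d<c (<-irrefl (sym c≡d)))

same-≡ : ∀ {a c} → SameOrder a a c c
same-≡ = mk⇔ (λ a<a → contradiction a<a (<-irrefl refl)) (λ c<c → contradiction c<c (<-irrefl refl)) ,
  mk⇔ (λ _ → refl) (λ _ → refl)

orderIsomorphic₃ : ∀ {x y z u v w} → SameOrder x y u v → SameOrder y x v u →
  SameOrder x z u w → SameOrder z x w u → SameOrder y z v w → SameOrder z y w v →
  OrderIsomorphic (x ∷ y ∷ z ∷ []) (u ∷ v ∷ w ∷ [])
orderIsomorphic₃ xy yx xz zx yz zy = λ where
  zero             zero             → same-≡
  zero             (suc zero)       → xy
  zero             (suc (suc zero)) → xz
  (suc zero)       zero             → yx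
  (suc zero)       (suc zero)       → same-≡
  (suc zero)       (suc (suc zero)) → yz
  (suc (suc zero)) zero             → zx
  (suc (suc zero)) (suc zero)       → zy
  (suc (suc zero)) (suc (suc zero)) → same-≡

Valleyless : Vec ℕ n → Set
Valleyless {n} v = ∀ {i j k : Fin n} → i Fin.< j → j Fin.< k → Returns (lookup v i) (lookup v j) (lookup v k)

0<1 : 0 < 1
0<1 = z<s

0<2 : 0 < 2
0<2 = z<s

1<2 : 1 < 2
1<2 = s<s z<s

-- In a valley the order of the outer entries decides which pattern occurs. Conversely, an
-- occurrence of either pattern is a valley, and the forced equality of its outer entries would
-- transfer to an equality of 1 and 2.
avoids⇔valleyless : (e : Vec ℕ n) → (Avoids pattern102 e × Avoids pattern201 e) ⇔ Valleyless e
avoids⇔valleyless e = mk⇔ forth back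
  where
  forth : Avoids pattern102 e × Avoids pattern201 e → Valleyless e
  forth (no102 , no201) {i} {j} {k} i<j j<k y<x y<z with <-cmp (lookup e k) (lookup e i)
  ... | tri≈ _ z≡x _ = z≡x
  ... | tri< z<x _ _ = contradiction
    (i , j , k , i<j , j<k , orderIsomorphic₃ (same-> y<x 0<2) (same-< y<x 0<2)
      (same-> z<x 1<2) (same-< z<x 1<2) (same-< y<z 0<1) (same-> y<z 0<1)) no201
  ... | tri> _ _ x<z = contradiction
    (i , j , k , i<j , j<k , orderIsomorphic₃ (same-> y<x 0<1) (same-< y<x 0<1)
      (same-< x<z 1<2) (same-> x<z 1<2) (same-< y<z 0<2) (same-> y<z 0<2)) no102

  back : Valleyless e → Avoids pattern102 e × Avoids pattern201 e
  back valleyless =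
    (λ (i , j , k , i<j , j<k , iso) → case to (proj₂ (iso (suc (suc zero)) zero))
       (valleyless i<j j<k (from (proj₁ (iso (suc zero) zero)) 0<1)
                           (from (proj₁ (iso (suc zero) (suc (suc zero)))) 0<2)) of λ ()) ,
    (λ (i , j , k , i<j , j<k , iso) → case to (proj₂ (iso (suc (suc zero)) zero))
       (valleyless i<j j<k (from (proj₁ (iso (suc zero) zero)) 0<2)
                           (from (proj₁ (iso (suc zero) (suc (suc zero)))) 0<1)) of λ ())

all-lookup⁺ : ∀ {P : ℕ → Set} {xs} → All P xs → ∀ i → P (lookup (fromList xs) i)
all-lookup⁺ (px ∷ pxs) zero    = px
all-lookup⁺ (px ∷ pxs) (suc i) = all-lookup⁺ pxs i

all-lookup⁻ : ∀ {P : ℕ → Set} xs → (∀ i → P (lookup (fromList xs) i)) → All P xs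
all-lookup⁻ []       p = []
all-lookup⁻ (x ∷ xs) p = p zero ∷ all-lookup⁻ xs (p ∘ suc)

module _ {R : ℕ → ℕ → Set} where

  allPairs-lookup⁺ : ∀ {xs} → AllPairs R xs → ∀ {i j} → i Fin.< j →
                     R (lookup (fromList xs) i) (lookup (fromList xs) j)
  allPairs-lookup⁺ (rx ∷ rxs) {zero}  {suc j} _         = all-lookup⁺ rx j
  allPairs-lookup⁺ (rx ∷ rxs) {suc i} {suc j} (s<s i<j) = allPairs-lookup⁺ rxs i<j

  allPairs-lookup⁻ : ∀ xs → (∀ {i j} → i Fin.< j →
                     R (lookup (fromList xs) i) (lookup (fromList xs) j)) → AllPairs R xs
  allPairs-lookup⁻ []       r = []
  allPairs-lookup⁻ (x ∷ xs) r = all-lookup⁻ xs (λ j → r {zero} {suc j} z<s) ∷ allPairs-lookup⁻ xs (r ∘ s<s)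

valleyless⇔good : ∀ xs → Valleyless (fromList xs) ⇔ Good xs
valleyless⇔good xs = mk⇔ (forth xs) back
  where
  forth : ∀ xs → Valleyless (fromList xs) → Good xs
  forth []       v = []
  forth (x ∷ xs) v = allPairs-lookup⁻ xs (λ j<k → v {zero} z<s (s<s j<k)) ∷
                     forth xs (λ i<j j<k → v (s<s i<j) (s<s j<k))

  back : ∀ {xs} → Good xs → Valleyless (fromList xs)
  back (rx ∷ good) {zero}  {suc j} {suc k} _         (s<s j<k) = allPairs-lookup⁺ rx j<k
  back (rx ∷ good) {suc i} {suc j} {suc k} (s<s i<j) (s<s j<k) = back good i<j j<k

-- Inversion bounds and rank on lists

data Inversion (c : ℕ) : List ℕ → Set where
  []  : Inversion c []
  _∷_ : ∀ {x xs} → x ≤ c → Inversion (suc c) xs → Inversion c (x ∷ xs)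

-- The offset `c` is the position of the head within the whole sequence, so that the condition
-- passes to suffixes.
inversion⇔ : ∀ c xs → (∀ i → lookup (fromList xs) i ≤ toℕ i + c) ⇔ Inversion c xs
inversion⇔ c []       = mk⇔ (λ _ → []) (λ _ ())
inversion⇔ c (x ∷ xs) = mk⇔
  (λ bound → bound zero ∷ to (inversion⇔ (suc c) xs)
    (λ i → ≤-trans (bound (suc i)) (≤-reflexive (sym (+-suc (toℕ i) c)))))
  (λ { (x≤c ∷ inv) zero    → x≤c
     ; (x≤c ∷ inv) (suc i) → ≤-trans (from (inversion⇔ (suc c) xs) inv i) (≤-reflexive (+-suc (toℕ i) c)) })

-- Solving for the position of the first descent removes the integers from the rest of the
-- combinatorial argument.
rank⇔ : ∀ f m t → pos f ℤ.- pos m ℤ.- pos 1 ≡ pos t ⇔ f ≡ suc (m + t)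
rank⇔ f m t = mk⇔
  (λ eq → ℤ.+-injective (begin
    pos f                                            ≡⟨ sym (cancel (pos f) (pos m)) ⟩
    pos m ℤ.+ (pos f ℤ.- pos m ℤ.- pos 1) ℤ.+ pos 1  ≡⟨ cong (λ z → pos m ℤ.+ z ℤ.+ pos 1) eq ⟩
    pos (m + t + 1)                                  ≡⟨ cong pos (+-comm (m + t) 1) ⟩
    pos (suc (m + t))                                ∎))
  (λ { refl → begin
    pos (suc (m + t)) ℤ.- pos m ℤ.- pos 1    ≡⟨ cong (λ k → pos k ℤ.- pos m ℤ.- pos 1) (+-comm 1 (m + t)) ⟩
    pos (m + t + 1) ℤ.- pos m ℤ.- pos 1      ≡⟨ cancel′ (pos m) (pos t) ⟩
    pos t                                    ∎ })
  where
  open ≡-Reasoning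
  cancel : ∀ f m → m ℤ.+ (f ℤ.- m ℤ.- pos 1) ℤ.+ pos 1 ≡ f
  cancel = solveℤ-∀
  cancel′ : ∀ m t → m ℤ.+ t ℤ.+ pos 1 ℤ.- m ℤ.- pos 1 ≡ t
  cancel′ = solveℤ-∀

ListAvoider : (t : ℕ) → List ℕ → Set
ListAvoider t xs = Inversion 0 xs × Good xs × fdes (fromList xs) ≡ suc (maxEntry (fromList xs) + t)

avoiderOfRank⇔ : ∀ t xs → AvoiderOfRank (length xs) t (fromList xs) ⇔ ListAvoider t xs
avoiderOfRank⇔ t xs = mk⇔
  (λ (inv , no102 , no201 , rank≡t) →
    to inv⇔ (λ i → ≤-trans (inv i) (m≤m+n (toℕ i) 0)) ,
    to (valleyless⇔good xs) (to (avoids⇔valleyless (fromList xs)) (no102 , no201)) ,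
    to rk⇔ rank≡t)
  (λ (inv , good , fdes≡) → let avoids = from (avoids⇔valleyless (fromList xs)) (from (valleyless⇔good xs) good) in
    (λ i → ≤-trans (from inv⇔ inv i) (≤-reflexive (+-identityʳ (toℕ i)))) ,
    proj₁ avoids , proj₂ avoids , from rk⇔ fdes≡)
  where
  inv⇔ = inversion⇔ 0 xs
  rk⇔  = rank⇔ (fdes (fromList xs)) (maxEntry (fromList xs)) t

-- Padding and truncation make this total, so that counting can be done on lists and transferred by
-- `card-image`; only lists of length `n` matter.
toVec : ∀ n → List ℕ → Vec ℕ n
toVec zero    _        = []
toVec (suc n) []       = 0 ∷ toVec n []
toVec (suc n) (x ∷ xs) = x ∷ toVec n xs

toVec-length : ∀ xs → toVec (length xs) xs ≡ fromList xs
toVec-length []       = refl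
toVec-length (x ∷ xs) = cong (x ∷_) (toVec-length xs)

toList-toVec : ∀ {n} xs → length xs ≡ n → Vec.toList (toVec n xs) ≡ xs
toList-toVec []       refl = refl
toList-toVec (x ∷ xs) refl = cong (x ∷_) (toList-toVec xs refl)

data FromList : Vec ℕ n → Set where
  ofList : ∀ xs → FromList (fromList xs)

fromList-view : (v : Vec ℕ n) → FromList v
fromList-view []      = ofList []
fromList-view (x ∷ v) with ofList xs ← fromList-view v = ofList (x ∷ xs)

card-vectors : ∀ {n t N} → HasCardinality (λ xs → length xs ≡ n × ListAvoider t xs) N →
               HasCardinality (AvoiderOfRank n t) N
card-vectors {n} {t} = card-⇔ (λ v → mk⇔ forth (λ av → back (fromList-view v) av)) ∘
  card-image (toVec n) λ {xs} {ys} (lx , _) (ly , _) eq →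
    trans (sym (toList-toVec xs lx)) (trans (cong Vec.toList eq) (toList-toVec ys ly))
  where
  forth : ∀ {n v} → (∃[ xs ] (length xs ≡ n × ListAvoider t xs) × v ≡ toVec n xs) → AvoiderOfRank n t v
  forth (xs , (refl , av) , refl) rewrite toVec-length xs = from (avoiderOfRank⇔ t xs) av

  back : ∀ {n v} → FromList v → AvoiderOfRank n t v → ∃[ xs ] (length xs ≡ n × ListAvoider t xs) × v ≡ toVec n xs
  back (ofList xs) av = xs , (refl , to (avoiderOfRank⇔ t xs) av) , sym (toVec-length xs)

-- The shape of an avoider

WeaklyDecreasing Prefix : (u : ℕ) → List ℕ → Set
WeaklyDecreasing = Descending (λ _ _ → ⊤)
Prefix           = Descending _≤_

-- The empty tail counts as a drop, in accordance with the convention that the sequence is followed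
-- by -1.
Drops : ℕ → List ℕ → Set
Drops m []      = ⊤
Drops m (y ∷ _) = y < m

all<⇒drops : ∀ {m xs} → All (_< m) xs → Drops m xs
all<⇒drops []        = tt
all<⇒drops (y<m ∷ _) = y<m

module _ {P : ℕ → ℕ → Set} where

  fdes-ʳ++ : ∀ {x} h s → Descending P (suc x) h →
             fdes (fromList (h ʳ++ (x ∷ s))) ≡ length h + fdes (fromList (x ∷ s))
  fdes-ʳ++ []      s []                           = refl
  fdes-ʳ++ {x} (y ∷ h) s ((s≤s y≤x , _) ∷ desc) = trans (fdes-ʳ++ h (x ∷ s) desc)
    -- `does (x <? y)` computes to the Boolean test `x <ᵇ y` inside `fdes`, so a decidability lemma
    -- settles the branch.
    (trans (cong (λ b → length h + (if b then 1 else suc (fdes (fromList (x ∷ s)))))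
              (dec-false (x <? y) (≤⇒≯ y≤x)))
           (+-suc (length h) _))

  maxEntry-ʳ++ : ∀ {x} h s → Descending P (suc x) h →
                 maxEntry (fromList (h ʳ++ (x ∷ s))) ≡ maxEntry (fromList (x ∷ s))
  maxEntry-ʳ++ []          s []                     = refl
  maxEntry-ʳ++ {x} (y ∷ h) s ((s≤s y≤x , _) ∷ desc) = trans (maxEntry-ʳ++ h (x ∷ s) desc)
    (m≤n⇒m⊔n≡n (≤-trans y≤x (m≤m⊔n x _)))

maxEntry-≤ : ∀ {m xs} → All (_≤ m) xs → maxEntry (fromList xs) ≤ m
maxEntry-≤ []            = z≤n
maxEntry-≤ (x≤m ∷ xs≤m) = ⊔-lub x≤m (maxEntry-≤ xs≤m)

fdes-drops : ∀ {m} r → Drops m r → fdes (fromList (m ∷ r)) ≡ 1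
fdes-drops []      _   = refl
fdes-drops {m} (y ∷ r) y<m =
  cong (λ b → if b then 1 else suc (fdes (fromList (y ∷ r)))) (dec-true (y <? m) y<m)

maxEntry-peak : ∀ {P m h r} → Descending P (suc m) h → All (_≤ m) r →
                maxEntry (fromList (h ʳ++ (m ∷ r))) ≡ m
maxEntry-peak {h = h} {r} desc r≤m = trans (maxEntry-ʳ++ h r desc) (m≥n⇒m⊔n≡m (maxEntry-≤ r≤m))

fdes-peak : ∀ {P m h r} → Descending P (suc m) h → Drops m r →
            fdes (fromList (h ʳ++ (m ∷ r))) ≡ suc (length h)
fdes-peak {h = h} {r} desc drops = trans (fdes-ʳ++ h r desc)
  (trans (cong (length h +_) (fdes-drops r drops)) (+-comm (length h) 1))

inversion-ʳ++ : ∀ {u h s} → Prefix u h → Inversion (length h) s → Inversion 0 (h ʳ++ s)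
inversion-ʳ++ []               inv = inv
inversion-ʳ++ ((_ , x≤) ∷ pre) inv = inversion-ʳ++ pre (x≤ ∷ inv)

inversion-≤ : ∀ {c xs} → All (_≤ c) xs → Inversion c xs
inversion-≤ []           = []
inversion-≤ (x≤c ∷ xs≤c) = x≤c ∷ inversion-≤ (All.map m≤n⇒m≤1+n xs≤c)

-- There is no valley to check: a middle entry in `p` is not below `x`, and after a middle entry in
-- `d` nothing rises.
returns-++ : ∀ {P x u d} p → All (x ≤_) p → Descending P u d → AllPairs (Returns x) (p ++ d)
returns-++ []      []           []            = []
returns-++ []      []           (_ ∷ desc)    =
  All.map (λ { (s≤s z≤y) _ y<z → contradiction z≤y (<⇒≱ y<z) }) (descending-< desc) ∷ returns-++ [] [] desc
returns-++ (y ∷ p) (x≤y ∷ x≤p) desc           =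
  All.universal (λ _ y<x → contradiction x≤y (<⇒≱ y<x)) _ ∷ returns-++ p x≤p desc

good-descending : ∀ {P u d} → Descending P u d → Good d
good-descending []         = []
good-descending (_ ∷ desc) = returns-++ [] [] desc ∷ good-descending desc

-- The prefix is unwound one entry at a time into `p`. Each new entry is at most everything already
-- there, so `returns-++` applies to it.
good-ʳ++ : ∀ {P Q x u h d} p → Descending P (suc x) h → All (x ≤_) p → Descending Q u d →
           Good (p ++ d) → Good (h ʳ++ (p ++ d))
good-ʳ++ p []                          x≤p desc good = good
good-ʳ++ {h = y ∷ _} p ((s≤s y≤x , _) ∷ pre) x≤p desc good =
  good-ʳ++ (y ∷ p) pre (≤-refl ∷ y≤p) desc (returns-++ p y≤p desc ∷ good)
  where y≤p = All.map (≤-trans y≤x) x≤p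

good-ʳ++⁻ : ∀ h {s} → Good (h ʳ++ s) → Good s × All (λ x → AllPairs (Returns x) s) h
good-ʳ++⁻ []      good = good , []
good-ʳ++⁻ (x ∷ h) good with rx ∷ good-s , rh ← good-ʳ++⁻ h good = good-s , rx ∷ All.map AllPairs.tail rh

-- The zipper at the first descent. Here `m` is only the entry before the descent; that it is the
-- maximum needs avoidance and is supplied by `returns-≤`.
record Peak (xs : List ℕ) : Set where
  constructor peak
  field
    {m}      : ℕ
    {h r}    : List ℕ
    ascent   : Prefix (suc m) h
    m≤h      : m ≤ length h
    drops    : Drops m r
    splits   : xs ≡ h ʳ++ (m ∷ r)

findPeak : ∀ {x} h s → Prefix (suc x) h → Inversion (length h) (x ∷ s) → Peak (h ʳ++ (x ∷ s))
findPeak h []      pre (x≤h ∷ _)   = peak pre x≤h tt refl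
findPeak {x} h (y ∷ s) pre (x≤h ∷ inv) with y <? x
... | yes y<x = peak pre x≤h y<x refl
... | no  y≮x = findPeak (x ∷ h) s ((s≤s (≮⇒≥ y≮x) , x≤h) ∷ pre) inv

-- Let `y` be the first entry after the peak. A later entry above `m` would also exceed `y`, so the
-- valley at `y` would force it to equal `m`.
returns-≤ : ∀ {m r} → Drops m r → AllPairs (Returns m) r → All (_≤ m) r
returns-≤ drops []        = []
returns-≤ {m} y<m (ry ∷ _) = <⇒≤ y<m ∷ All.map (λ {z} r → case z ≤? m of λ
  { (yes z≤m) → z≤m ; (no z≰m) → ≤-reflexive (r y<m (<-trans y<m (≰⇒> z≰m))) }) ry

-- A rise within the tail would form a valley with `m` and so would have to reach `m`, which is
-- excluded.
returns-descending : ∀ {m r} → All (_< m) r → AllPairs (Returns m) r → WeaklyDecreasing m r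
returns-descending []          []        = []
returns-descending (y<m ∷ r<m) (ry ∷ rr) = (y<m , tt) ∷ tighten
  (All.zipWith (λ (z<m , r) → s≤s (≮⇒≥ λ y<z → <⇒≢ z<m (r y<m y<z))) (r<m , ry))
  (returns-descending r<m rr)

module _ {j m : ℕ} (j<m : j < m) where

  -- Seen from `m`, a middle letter `j` can be followed by a rise only to the letter `m`, which is a
  -- return; the entries of `d` stay below `j`.
  returns-letters : ∀ {P w d} → All (Letter j m) w → Descending P j d → AllPairs (Returns m) (w ++ d)
  returns-letters []                 desc = returns-++ [] [] desc
  returns-letters (inj₂ refl ∷ letters) desc =
    All.universal (λ _ m<m → contradiction m<m (<-irrefl refl)) _ ∷ returns-letters letters desc
  returns-letters (inj₁ refl ∷ letters) desc =
    All.++⁺ (All.map (λ { (inj₁ refl) _ j<j → contradiction j<j (<-irrefl refl) ; (inj₂ refl) _ _ → refl }) letters)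
            (All.map (λ z<j _ j<z → contradiction z<j (<-asym j<z)) (descending-< desc))
    ∷ returns-letters letters desc

  letters-≥ : ∀ {w} → All (Letter j m) w → All (j ≤_) w
  letters-≥ = All.map λ { (inj₁ refl) → ≤-refl ; (inj₂ refl) → <⇒≤ j<m }

  good-letters : ∀ {P w d} → All (Letter j m) w → Descending P j d → Good (w ++ d)
  good-letters []                    desc = good-descending desc
  good-letters (inj₁ refl ∷ letters) desc =
    returns-++ _ (letters-≥ letters) desc ∷ good-letters letters desc
  good-letters (inj₂ refl ∷ letters) desc =
    returns-letters letters desc ∷ good-letters letters desc

  -- The copies of `m` ending the prefix are letters too. Once they are moved into the word, the
  -- remaining prefix lies weakly below all letters and `good-ʳ++` applies.
  good-prefix-letters : ∀ {P Q g w d} i → Descending P (suc j) g → All (Letter j m) w → Descending Q j d →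
    Good ((replicate i m ++ g) ʳ++ (w ++ d))
  good-prefix-letters zero    pre letters desc =
    good-ʳ++ _ pre (letters-≥ letters) desc (good-letters letters desc)
  good-prefix-letters (suc i) pre letters desc = good-prefix-letters i pre (inj₂ refl ∷ letters) desc

  prefix-replicate : ∀ {g} i → m ≤ length g → Prefix (suc j) g → Prefix (suc m) (replicate i m ++ g)
  prefix-replicate zero    m≤g pre = weaken (s≤s (<⇒≤ j<m)) pre
  prefix-replicate {g} (suc i) m≤g pre = (≤-refl , m≤) ∷ prefix-replicate i m≤g pre
    where
    m≤ : m ≤ length (replicate i m ++ g)
    m≤ = ≤-trans m≤g (≤-trans (m≤n+m (length g) _) (≤-reflexive (sym (length-++ (replicate i m)))))

  -- The word ends at the first entry `z < j`: a later entry above `z` would have to return both to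
  -- `j` and to `m`. Everything from `z` on is therefore weakly decreasing.
  splitLetters : ∀ r → All (λ z → z ≤ j ⊎ z ≡ m) r → AllPairs (Returns m) r → AllPairs (Returns j) r →
    ∃[ w ] ∃[ d ] r ≡ w ++ d × All (Letter j m) w × WeaklyDecreasing j d
  splitLetters []      []         _         _         = [] , [] , refl , [] , []
  splitLetters (z ∷ r) (bz ∷ br) (mz ∷ mr) (jz ∷ jr) with splitLetters r br mr jr | bz
  ... | w , d , refl , letters , desc | inj₂ z≡m = z ∷ w , d , refl , inj₂ z≡m ∷ letters , desc
  ... | w , d , refl , letters , desc | inj₁ z≤j with m≤n⇒m<n∨m≡n z≤j
  ...   | inj₂ z≡j = z ∷ w , d , refl , inj₁ z≡j ∷ letters , desc
  -- Whatever the recursive call took for letters is bounded by `z` and joins the decreasing part.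
  ...   | inj₁ z<j = [] , z ∷ w ++ d , refl , [] ,
      returns-descending (z<j ∷ All.map (λ y≤z → ≤-<-trans y≤z z<j) r≤z) (jz ∷ jr)
    where
    r≤z : All (_≤ z) (w ++ d)
    r≤z = All.zipWith (λ (ret-j , ret-m) → ≮⇒≥ λ z<y →
      <-irrefl (trans (sym (ret-j z<j z<y)) (ret-m (<-trans z<j j<m) z<y)) j<m) (jz , mz)

  -- The prefix is stored with its largest entries in front, so the copies of `m` come first. The
  -- bound `m ≤ length g` is the inversion condition at the last copy removed, or the hypothesis
  -- itself if there is none.
  splitPrefix : ∀ h → All (λ x → x ≤ j ⊎ x ≡ m) h → Prefix (suc m) h → m ≤ length h →
    ∃[ i ] ∃[ g ] h ≡ replicate i m ++ g × Prefix (suc j) g × m ≤ length g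
  splitPrefix []      _  _   m≤0 = 0 , [] , refl , [] , m≤0
  splitPrefix (x ∷ h) (inj₂ refl ∷ bh) ((_ , m≤h) ∷ pre) _ with splitPrefix h bh pre m≤h
  ... | i , g , refl , pre-g , m≤g = suc i , g , refl , pre-g , m≤g
  splitPrefix (x ∷ h) (inj₁ x≤j ∷ bh) ((_ , x≤h) ∷ pre) m≤ =
    0 , x ∷ h , refl , (s≤s x≤j , x≤h) ∷ pre , m≤

ʳ++-injective : ∀ {xs ys us vs : List ℕ} → length xs ≡ length ys → xs ʳ++ us ≡ ys ʳ++ vs → xs ≡ ys × us ≡ vs
ʳ++-injective {[]}     {[]}     _  eq = refl , eq
ʳ++-injective {x ∷ xs} {y ∷ ys} lx eq with ʳ++-injective {xs} {ys} (suc-injective lx) eq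
... | refl , refl = refl , refl

-- The cut is visible in the concatenation: it lies just before the first entry below `b`.
++-injective-threshold : ∀ {b} {xs ys us vs : List ℕ} → All (b ≤_) xs → All (b ≤_) ys →
  All (_< b) us → All (_< b) vs → xs ++ us ≡ ys ++ vs → xs ≡ ys × us ≡ vs
++-injective-threshold []          []          _         _         eq   = refl , eq
++-injective-threshold []          (b≤y ∷ _)   (y<b ∷ _) _         refl = contradiction b≤y (<⇒≱ y<b)
++-injective-threshold (b≤x ∷ _)   []          _         (x<b ∷ _) refl = contradiction b≤x (<⇒≱ x<b)
++-injective-threshold (_ ∷ b≤xs) (_ ∷ b≤ys) us<b      vs<b      eq
  with refl , eq′ ← ∷-injective eq
  with refl , refl ← ++-injective-threshold b≤xs b≤ys us<b vs<b eq′ = refl , refl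

≤∸⇒+≤ : ∀ {k n o} → o ≤ n → k ≤ n ∸ o → k + o ≤ n
≤∸⇒+≤ {o = o} o≤n k≤ = ≤-trans (+-monoˡ-≤ o k≤) (≤-reflexive (m∸n+n≡m o≤n))

-- A positive number below `n ∸ o` shows that the subtraction does not truncate.
0<≤∸⇒+≤ : ∀ {k} n o → 1 ≤ k → k ≤ n ∸ o → k + o ≤ n
0<≤∸⇒+≤ n o 1≤k k≤ = ≤∸⇒+≤ (<⇒≤ (positive⇒< (≤-trans 1≤k k≤))) k≤
  where
  positive⇒< : 0 < n ∸ o → o < n
  positive⇒< 0< = ≰⇒> λ n≤o → <⇒≢ 0< (sym (m≤n⇒m∸n≡0 n≤o))

-- Parametrisation by plain and marked data

PlainData : Set
PlainData = ℕ × List ℕ × List ℕ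

-- The numerical components follow the order of the nested sums in `b`, so that `card-∑` and
-- `card-×` produce those sums directly.
MarkedData : Set
MarkedData = ℕ × ℕ × ℕ × ℕ × List ℕ × List ℕ × List ℕ

IsPlain : (n t : ℕ) → PlainData → Set
IsPlain n t (m , h , d) =
  (1 ≤ m × m ≤ n ∸ t ∸ 1) ×
  (length h ≡ m + t × Prefix (suc m) h) ×
  (length d ≡ n ∸ suc (m + t) × WeaklyDecreasing m d)

-- The word `w` starts after the `j` that opens the tail. Hence the 3 in the length of `d`: the
-- peak, that `j`, and the extra letter in `k + 1`. The value `j = 0` is included here and split off
-- in the evaluation.
IsMarked : (n t : ℕ) → MarkedData → Set
IsMarked n t (m , j , s , k , w , g , d) =
  (1 ≤ m × m ≤ n ∸ t ∸ 3) × (0 ≤ j × j ≤ m ∸ 1) × (0 ≤ s × s ≤ t) × (0 ≤ k × k ≤ n ∸ m ∸ t ∸ 3) ×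
  (length w ≡ k + 1 × All (Letter j m) w × m ∈ w) ×
  (length g ≡ m + s × Prefix (suc j) g) ×
  (length d ≡ n ∸ (m + t + k + 3) × WeaklyDecreasing j d)

plain : PlainData → List ℕ
plain (m , h , d) = h ʳ++ (m ∷ d)

marked : ℕ → MarkedData → List ℕ
marked t (m , j , s , k , w , g , d) = (replicate (t ∸ s) m ++ g) ʳ++ (m ∷ j ∷ w ++ d)

plainTerm : (n t m : ℕ) → ℕ
plainTerm n t m = prefixes (suc m) (m + t) * weaklyDecreasings m (n ∸ suc (m + t))

markedTerm : (n t m j s k : ℕ) → ℕ
markedTerm n t m j s k =
  (2 ^ (k + 1) ∸ 1) * (prefixes (suc j) (m + s) * weaklyDecreasings j (n ∸ (m + t + k + 3)))

1≤m∧j≤m∸1⇒j<m : ∀ {m j} → 1 ≤ m → j ≤ m ∸ 1 → j < m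
1≤m∧j≤m∸1⇒j<m (s≤s _) j≤ = s≤s j≤

markedCount : (n t m j : ℕ) → ℕ
markedCount n t m j = ∑ℕ 0 t λ s → ∑ℕ 0 (n ∸ m ∸ t ∸ 3) λ k → markedTerm n t m j s k

card-prefix : ∀ u l → HasCardinality (λ xs → length xs ≡ l × Prefix u xs) (prefixes u l)
card-prefix = card-descending _≤?_

card-weaklyDecreasing : ∀ u l → HasCardinality (λ xs → length xs ≡ l × WeaklyDecreasing u xs) (weaklyDecreasings u l)
card-weaklyDecreasing = card-descending (λ _ _ → yes tt)

card-plain : ∀ n t → HasCardinality (IsPlain n t) (∑ℕ 1 (n ∸ t ∸ 1) (plainTerm n t))
card-plain n t = card-∑ 1 (n ∸ t ∸ 1) {size = plainTerm n t} λ {m} _ _ →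
  card-× (card-prefix (suc m) (m + t)) (card-weaklyDecreasing m (n ∸ suc (m + t)))

card-marked : ∀ n t → HasCardinality (IsMarked n t)
  (∑ℕ 1 (n ∸ t ∸ 3) λ m → ∑ℕ 0 (m ∸ 1) (markedCount n t m))
card-marked n t =
  card-∑ 1 (n ∸ t ∸ 3) {size = λ m → ∑ℕ 0 (m ∸ 1) (markedCount n t m)} λ {m} 1≤m _ →
  card-∑ 0 (m ∸ 1) {size = markedCount n t m} λ {j} _ j≤ →
  card-∑ 0 t {size = λ s → ∑ℕ 0 (n ∸ m ∸ t ∸ 3) (markedTerm n t m j s)} λ {s} _ _ →
  card-∑ 0 (n ∸ m ∸ t ∸ 3) {size = markedTerm n t m j s} λ {k} _ _ →
  card-× (card-words-∋ (1≤m∧j≤m∸1⇒j<m 1≤m j≤) (k + 1))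
    (card-× (card-prefix (suc j) (m + s)) (card-weaklyDecreasing j (n ∸ (m + t + k + 3))))

plain-size : ∀ {n t m} → 1 ≤ m → m ≤ n ∸ t ∸ 1 → suc (m + t) ≤ n
plain-size {n} {t} {m} 1≤m m≤ = ≤-trans (≤-reflexive (regroup m t))
  (0<≤∸⇒+≤ n (t + 1) 1≤m (≤-trans m≤ (≤-reflexive (∸-+-assoc n t 1))))
  where
  regroup : ∀ m t → suc (m + t) ≡ m + (t + 1)
  regroup = solve-∀

∸∸∸ : ∀ n m t → n ∸ m ∸ t ∸ 3 ≡ n ∸ (m + t + 3)
∸∸∸ n m t = trans (cong (_∸ 3) (∸-+-assoc n m t)) (∸-+-assoc n (m + t) 3)

marked-size : ∀ {n t m k} → 1 ≤ m → m ≤ n ∸ t ∸ 3 → k ≤ n ∸ m ∸ t ∸ 3 → m + t + k + 3 ≤ n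
marked-size {n} {t} {m} {k} 1≤m m≤ k≤ = ≤-trans (≤-reflexive (regroup m t k))
  (≤∸⇒+≤ (≤-trans (≤-reflexive (+-assoc m t 3))
            (0<≤∸⇒+≤ n (t + 3) 1≤m (≤-trans m≤ (≤-reflexive (∸-+-assoc n t 3)))))
         (≤-trans k≤ (≤-reflexive (∸∸∸ n m t))))
  where
  regroup : ∀ m t k → m + t + k + 3 ≡ k + (m + t + 3)
  regroup = solve-∀

-- What the two families share at the first descent; it is enough to recover `m`, `h` and `r` from
-- the sequence.
record PeakOfRank (t m : ℕ) (h r : List ℕ) : Set where
  field
    ascent : Prefix (suc m) h
    length≡ : length h ≡ m + t
    drops  : Drops m r
    bounded : All (_≤ m) r

open PeakOfRank

avoider-peak : ∀ {t m h r} → PeakOfRank t m h r → Good (h ʳ++ (m ∷ r)) → ListAvoider t (h ʳ++ (m ∷ r))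
avoider-peak {t} {m} {h} {r} pk good =
  -- Entries after the peak are at most `m`, hence at most the position of the peak, so their
  -- inversion bounds are automatic.
  inversion-ʳ++ (ascent pk) (m≤h ∷ inversion-≤ (All.map (λ x≤m → m≤n⇒m≤1+n (≤-trans x≤m m≤h)) (bounded pk))) ,
  good ,
  trans (fdes-peak (ascent pk) (drops pk)) (cong suc (trans (length≡ pk) (cong (_+ t) (sym (maxEntry-peak (ascent pk) (bounded pk))))))
  where
  m≤h : m ≤ length h
  m≤h = ≤-trans (m≤m+n m t) (≤-reflexive (sym (length≡ pk)))

plain-peak : ∀ {n t m h d} → IsPlain n t (m , h , d) → PeakOfRank t m h d
plain-peak (_ , (lh , pre) , (_ , desc)) = record
  { ascent = pre ; length≡ = lh ; drops = all<⇒drops d<m ; bounded = All.map <⇒≤ d<m }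
  where d<m = descending-< desc

plain-sound : ∀ {n t z} → IsPlain n t z → length (plain z) ≡ n × ListAvoider t (plain z)
plain-sound {n} {t} {m , h , d} isPlain@((1≤m , m≤) , (lh , pre) , (ld , desc)) =
  (begin
    length (h ʳ++ (m ∷ d))               ≡⟨ length-ʳ++ h ⟩
    length h + suc (length d)            ≡⟨ cong₂ (λ x y → x + suc y) lh ld ⟩
    m + t + suc (n ∸ suc (m + t))        ≡⟨ +-suc (m + t) _ ⟩
    suc (m + t) + (n ∸ suc (m + t))      ≡⟨ m+[n∸m]≡n (plain-size {t = t} 1≤m m≤) ⟩
    n                                    ∎) ,
  avoider-peak (plain-peak {n} isPlain)
    (good-ʳ++ (m ∷ []) pre (≤-refl ∷ []) desc (returns-++ [] [] desc ∷ good-descending desc))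
  where open ≡-Reasoning

marked-peak : ∀ {n t m j s k w g d} → IsMarked n t (m , j , s , k , w , g , d) →
              PeakOfRank t m (replicate (t ∸ s) m ++ g) (j ∷ w ++ d)
marked-peak {t = t} {m} {j} {s} {g = g}
  ((1≤m , _) , (_ , j≤) , (_ , s≤t) , _ , (_ , letters , _) , (lg , pre) , (_ , desc)) = record
  { ascent  = prefix-replicate j<m (t ∸ s) (≤-trans (m≤m+n m s) (≤-reflexive (sym lg))) pre
  ; length≡ = begin
      length (replicate (t ∸ s) m ++ g)         ≡⟨ length-++ (replicate (t ∸ s) m) ⟩
      length (replicate (t ∸ s) m) + length g   ≡⟨ cong₂ _+_ (length-replicate (t ∸ s)) lg ⟩
      t ∸ s + (m + s)                           ≡⟨ regroup (t ∸ s) m s ⟩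
      m + (t ∸ s + s)                           ≡⟨ cong (m +_) (m∸n+n≡m s≤t) ⟩
      m + t                                     ∎
  ; drops   = j<m
  ; bounded = <⇒≤ j<m ∷ All.++⁺
      (All.map (λ { (inj₁ refl) → <⇒≤ j<m ; (inj₂ refl) → ≤-refl }) letters)
      (All.map (λ z<j → <⇒≤ (<-trans z<j j<m)) (descending-< desc))
  }
  where
  open ≡-Reasoning
  j<m : j < m
  j<m = 1≤m∧j≤m∸1⇒j<m 1≤m j≤
  regroup : ∀ p m s → p + (m + s) ≡ m + (p + s)
  regroup = solve-∀

marked-sound : ∀ {n t z} → IsMarked n t z → length (marked t z) ≡ n × ListAvoider t (marked t z)
marked-sound {n} {t} {z@(m , j , s , k , w , g , d)}
  isMarked@((1≤m , m≤) , (_ , j≤) , _ , (_ , k≤) , (lw , letters , _) , (_ , pre) , (ld , desc)) =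
  (begin
    length (marked t z)                              ≡⟨ length-ʳ++ (replicate (t ∸ s) m ++ g) ⟩
    length (replicate (t ∸ s) m ++ g) + suc (suc (length (w ++ d)))
      ≡⟨ cong₂ (λ x y → x + suc (suc y)) (length≡ (marked-peak {n} isMarked)) (trans (length-++ w) (cong₂ _+_ lw ld)) ⟩
    m + t + suc (suc (k + 1 + (n ∸ (m + t + k + 3))))  ≡⟨ regroup m t k _ ⟩
    m + t + k + 3 + (n ∸ (m + t + k + 3))            ≡⟨ m+[n∸m]≡n (marked-size {t = t} 1≤m m≤ k≤) ⟩
    n                                                ∎) ,
  avoider-peak (marked-peak {n} isMarked)
    -- The peak and the `j` after it are counted as the first two letters of the word.
    (good-prefix-letters (1≤m∧j≤m∸1⇒j<m 1≤m j≤) (t ∸ s) pre (inj₂ refl ∷ inj₁ refl ∷ letters) desc)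
  where
  open ≡-Reasoning
  regroup : ∀ m t k x → m + t + suc (suc (k + 1 + x)) ≡ m + t + k + 3 + x
  regroup = solve-∀

-- The maximum of the sequence gives `m`; together with `t` it gives the length of the prefix and so
-- the place to cut.
peak-unique : ∀ {t m m′ h h′ r r′} → PeakOfRank t m h r → PeakOfRank t m′ h′ r′ →
  h ʳ++ (m ∷ r) ≡ h′ ʳ++ (m′ ∷ r′) → m ≡ m′ × h ≡ h′ × r ≡ r′
peak-unique {t} {h = h} {h′} pk pk′ eq
  with refl ← trans (sym (maxEntry-peak {h = h} (ascent pk) (bounded pk)))
                (trans (cong (maxEntry ∘ fromList) eq) (maxEntry-peak {h = h′} (ascent pk′) (bounded pk′)))
  with refl , refl ← ʳ++-injective {h} {h′} (trans (length≡ pk) (sym (length≡ pk′))) eq = refl , refl , refl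

plain-injective : ∀ {n t z z′} → IsPlain n t z → IsPlain n t z′ → plain z ≡ plain z′ → z ≡ z′
plain-injective {n} isPlain isPlain′ eq
  with refl , refl , refl ← peak-unique (plain-peak {n} isPlain) (plain-peak {n} isPlain′) eq = refl

-- After the cut at the peak, `j` is the head of the tail. The threshold `j` separates `w` from `d`,
-- the threshold `m` separates the copies of `m` from `g`, and lengths give `s` and `k`.
marked-injective : ∀ {n t z z′} → IsMarked n t z → IsMarked n t z′ → marked t z ≡ marked t z′ → z ≡ z′
marked-injective {n} {t} {m , j , s , k , w , g , d} {m′ , j′ , s′ , k′ , w′ , g′ , d′}
  isMarked@((1≤m , _) , (_ , j≤) , _ , _ , (lw , letters , _) , (lg , pre) , (_ , desc))
  isMarked′@(_ , _ , _ , _ , (lw′ , letters′ , _) , (lg′ , pre′) , (_ , desc′)) eq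
  with refl , h≡ , r≡ ← peak-unique (marked-peak {n} isMarked) (marked-peak {n} isMarked′) eq
  with refl , wd≡ ← ∷-injective r≡
  with j<m ← 1≤m∧j≤m∸1⇒j<m 1≤m j≤
  with refl , refl ← ++-injective-threshold (letters-≥ j<m letters) (letters-≥ j<m letters′)
                       (descending-< desc) (descending-< desc′) wd≡
     | _ , refl ← ++-injective-threshold (All.replicate⁺ (t ∸ s) ≤-refl) (All.replicate⁺ (t ∸ s′) ≤-refl)
                    (All.map (λ x≤j → ≤-<-trans (s≤s⁻¹ x≤j) j<m) (descending-< pre))
                    (All.map (λ x≤j → ≤-<-trans (s≤s⁻¹ x≤j) j<m) (descending-< pre′)) h≡
  with refl ← +-cancelˡ-≡ m s s′ (trans (sym lg) lg′)
     | refl ← +-cancelʳ-≡ 1 k k′ (trans (sym lw) lw′) = refl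

plain≢marked : ∀ {n t z z′} → IsPlain n t z → IsMarked n t z′ → plain z ≢ marked t z′
plain≢marked {n} isPlain@(_ , _ , (_ , desc)) isMarked@(_ , _ , _ , _ , (_ , _ , m∈w) , _) eq
  with refl , _ , refl ← peak-unique (plain-peak {n} isPlain) (marked-peak {n} isMarked) eq =
  <-irrefl refl (All.lookup (descending-< desc) (there (∈-++⁺ˡ m∈w)))

-- Completeness of the two families

IsShape : (n t : ℕ) → List ℕ → Set
IsShape n t xs = (∃[ z ] IsPlain n t z × xs ≡ plain z) ⊎ (∃[ z ] IsMarked n t z × xs ≡ marked t z)

plain-complete : ∀ {t m h r} → t + 2 ≤ length h + suc (length r) → Prefix (suc m) h → length h ≡ m + t →
  All (_< m) r → AllPairs (Returns m) r → IsPlain (length (h ʳ++ (m ∷ r))) t (m , h , r)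
plain-complete {t} {m} {h} {r} t+2≤ pre lh r<m rr =
  (1≤m r<m t+2≤ lh , subst (m ≤_) (sym (trans (cong (λ k → k ∸ t ∸ 1) len) (∸-+-assoc _ t 1)))
     (m+n≤o⇒m≤o∸n m (≤-trans (≤-reflexive (regroup m t)) (m≤m+n _ (length r))))) ,
  (lh , pre) ,
  (sym (trans (cong (_∸ suc (m + t)) len) (m+n∸m≡n (suc (m + t)) (length r))) , returns-descending r<m rr)
  where
  len : length (h ʳ++ (m ∷ r)) ≡ suc (m + t) + length r
  len = trans (length-ʳ++ h) (trans (+-suc (length h) (length r)) (cong (λ k → suc (k + length r)) lh))
  regroup : ∀ m t → m + (t + 1) ≡ suc (m + t)
  regroup = solve-∀
  1≤m : ∀ {m r l} → All (_< m) r → t + 2 ≤ l + suc (length r) → l ≡ m + t → 1 ≤ m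
  1≤m {suc m} _ _ _ = s≤s z≤n
  -- If `m = 0`, nothing is below the peak, so the tail is empty and the length is only `t + 1`;
  -- this is where `t ≤ n - 2` enters.
  1≤m {zero} [] t+2≤ lh = contradiction (+-cancelˡ-≤ t 2 1 (subst (λ k → t + 2 ≤ k + 1) lh t+2≤)) λ { (s≤s ()) }

marked-complete : ∀ {t m h r} → Good (h ʳ++ (m ∷ r)) → Prefix (suc m) h → length h ≡ m + t →
  Drops m r → m ∈ r → ∃[ z ] IsMarked (length (h ʳ++ (m ∷ r))) t z × h ʳ++ (m ∷ r) ≡ marked t z
marked-complete {r = j ∷ r} good pre lh j<m (here refl) = contradiction j<m (<-irrefl refl)
marked-complete {t} {m} {h} {j ∷ r} good pre lh j<m (there m∈r)
  with ((mj ∷ mr) ∷ jr ∷ _) , rh ← good-ʳ++⁻ h good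
  with w , d , refl , letters , desc ← splitLetters j<m r
         -- The valley from the peak over `j` forces every later entry above `j` to be `m`.
         (All.map (λ {z} ret → case z ≤? j of λ
            { (yes z≤j) → inj₁ z≤j ; (no z≰j) → inj₂ (ret j<m (≰⇒> z≰j)) }) mj) mr jr
     | i , g , refl , pre-g , m≤g ← splitPrefix j<m h
         -- Since `m` recurs after `j`, a prefix entry `x` above `j` forms a valley with `j` and
         -- that `m`, and so equals `m`.
         (All.map (λ { {x} (_ ∷ xj ∷ _) → case x ≤? j of λ
            { (yes x≤j) → inj₁ x≤j ; (no x≰j) → inj₂ (sym (All.lookup xj m∈r (≰⇒> x≰j) j<m)) } }) rh)
         pre (≤-trans (m≤m+n m t) (≤-reflexive (sym lh)))
  = (m , j , s , k , w , g , d) ,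
    ((≤-trans (s≤s z≤n) j<m ,
      subst (m ≤_) (sym (∸-+-assoc size t 3)) (m+n≤o⇒m≤o∸n m (n≥ (drop-k m t k)))) ,
     (z≤n , <⇒≤pred j<m) ,
     (z≤n , m+n≤o⇒n≤o i (≤-reflexive i+s≡t)) ,
     (z≤n , subst (k ≤_) (sym (∸∸∸ size m t)) (m+n≤o⇒m≤o∸n k (n≥ (rotate-k m t k)))) ,
     (lw , letters , m∈w) ,
     (lg , pre-g) ,
     (sym (trans (cong (_∸ (m + t + k + 3)) n≡) (m+n∸m≡n (m + t + k + 3) (length d))) , desc)) ,
    cong (λ i → (replicate i m ++ g) ʳ++ (m ∷ j ∷ w ++ d))
      (sym (trans (cong (_∸ s) (sym i+s≡t)) (m+n∸n≡m i s)))
  where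
  open ≡-Reasoning
  s = length g ∸ m
  k = length w ∸ 1
  size = length ((replicate i m ++ g) ʳ++ (m ∷ j ∷ w ++ d))
  lg : length g ≡ m + s
  lg = sym (m+[n∸m]≡n m≤g)
  m∈w : m ∈ w
  m∈w = [ id , (λ m∈d → contradiction (All.lookup (descending-< desc) m∈d) (<-asym j<m)) ]′ (∈-++⁻ w m∈r)
  lw : length w ≡ k + 1
  lw = sym (m∸n+n≡m (nonempty m∈w))
    where
    nonempty : ∀ {w} → m ∈ w → 1 ≤ length w
    nonempty (here _)  = s≤s z≤n
    nonempty (there _) = s≤s z≤n
  i+s≡t : i + s ≡ t
  i+s≡t = +-cancelˡ-≡ m _ _ (begin
    m + (i + s)                      ≡⟨ regroup m i s ⟩
    i + (m + s)                      ≡⟨ cong₂ _+_ (sym (length-replicate i)) (sym lg) ⟩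
    length (replicate i m) + length g ≡⟨ sym (length-++ (replicate i m)) ⟩
    length (replicate i m ++ g)      ≡⟨ lh ⟩
    m + t                            ∎)
    where
    regroup : ∀ m i s → m + (i + s) ≡ i + (m + s)
    regroup = solve-∀
  n≡ : size ≡ m + t + k + 3 + length d
  n≡ = begin
    size                                                    ≡⟨ length-ʳ++ (replicate i m ++ g) ⟩
    length (replicate i m ++ g) + suc (suc (length (w ++ d)))
      ≡⟨ cong₂ (λ x y → x + suc (suc y)) lh (trans (length-++ w) (cong (_+ length d) lw)) ⟩
    m + t + suc (suc (k + 1 + length d))                 ≡⟨ regroup m t k (length d) ⟩
    m + t + k + 3 + length d                             ∎
    where
    regroup : ∀ m t k x → m + t + suc (suc (k + 1 + x)) ≡ m + t + k + 3 + x
    regroup = solve-∀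
  n≥ : ∀ {p} → p ≤ m + t + k + 3 → p ≤ size
  n≥ p≤ = ≤-trans p≤ (≤-trans (m≤m+n _ (length d)) (≤-reflexive (sym n≡)))
  drop-k : ∀ m t k → m + (t + 3) ≤ m + t + k + 3
  drop-k m t k = m+n≤o⇒m≤o (m + (t + 3)) {k} (≤-reflexive (eq m t k))
    where
    eq : ∀ m t k → m + (t + 3) + k ≡ m + t + k + 3
    eq = solve-∀
  rotate-k : ∀ m t k → k + (m + t + 3) ≤ m + t + k + 3
  rotate-k m t k = ≤-reflexive (eq m t k)
    where
    eq : ∀ m t k → k + (m + t + 3) ≡ m + t + k + 3
    eq = solve-∀

complete : ∀ {n t xs} → t + 2 ≤ n → length xs ≡ n → ListAvoider t xs → IsShape n t xs
complete {t = t} {[]} t+2≤n refl _ = contradiction (m+n≤o⇒n≤o t t+2≤n) λ ()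
complete {t = t} {x ∷ xs} t+2≤n refl (inv , good , fdes≡) with findPeak [] xs [] inv
... | peak {m} {h} {r} pre m≤h drops xs≡ =
  subst (λ ys → IsShape (length ys) t ys) (sym xs≡)
    (shape (subst (λ ys → t + 2 ≤ length ys) xs≡ t+2≤n)
           (subst Good xs≡ good)
           (subst (λ ys → fdes (fromList ys) ≡ suc (maxEntry (fromList ys) + t)) xs≡ fdes≡))
  where
  shape : t + 2 ≤ length (h ʳ++ (m ∷ r)) → Good (h ʳ++ (m ∷ r)) →
          fdes (fromList (h ʳ++ (m ∷ r))) ≡ suc (maxEntry (fromList (h ʳ++ (m ∷ r))) + t) →
          IsShape (length (h ʳ++ (m ∷ r))) t (h ʳ++ (m ∷ r))
  shape t+2≤ good fdes≡ with (rm ∷ _) , _ ← good-ʳ++⁻ h good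
    -- With `m` known to be the maximum, the rank condition becomes a statement about the length of
    -- the prefix.
    with lh ← suc-injective (trans (sym (fdes-peak {h = h} pre drops))
                (trans fdes≡ (cong (λ k → suc (k + t)) (maxEntry-peak {h = h} pre (returns-≤ drops rm)))))
    with m ∈? r
  ... | yes m∈r = inj₂ (marked-complete good pre lh drops m∈r)
  ... | no  m∉r = inj₁ ((m , h , r) ,
    plain-complete (≤-trans t+2≤ (≤-reflexive (length-ʳ++ h))) pre lh
      (All.tabulate λ z∈r → ≤∧≢⇒< (All.lookup (returns-≤ drops rm) z∈r) λ { refl → m∉r z∈r }) rm ,
    refl)

card-listAvoider : ∀ {n t} → t + 2 ≤ n → HasCardinality (λ xs → length xs ≡ n × ListAvoider t xs)
  (∑ℕ 1 (n ∸ t ∸ 1) (plainTerm n t) +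
   ∑ℕ 1 (n ∸ t ∸ 3) λ m → ∑ℕ 0 (m ∸ 1) (markedCount n t m))
card-listAvoider {n} {t} t+2≤n = card-⇔
  (λ xs → mk⇔
    (λ { (inj₁ (z , isPlain , refl)) → plain-sound isPlain
       ; (inj₂ (z , isMarked , refl)) → marked-sound isMarked })
    (λ (len , avoider) → complete t+2≤n len avoider))
  (card-⊎ (λ { _ (_ , isPlain , refl) (_ , isMarked , eq) → plain≢marked isPlain isMarked eq })
    (card-image plain (plain-injective {n}) (card-plain n t))
    (card-image (marked t) (marked-injective {n}) (card-marked n t)))

-- Evaluation of the counts

∑ℕ-cong : ∀ lo hi {f g : ℕ → ℕ} → (∀ i → f i ≡ g i) → ∑ℕ lo hi f ≡ ∑ℕ lo hi g
∑ℕ-cong lo hi eq = cong sum (map-cong (λ i → eq (lo + i)) (upTo (suc hi ∸ lo)))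

fromℕ-prefixes : ∀ v w l → l ≡ v + w → fromℕ (prefixes (suc v) l) ≡
  (pos (suc w) ℚ./ suc l) ℚ.* fromℕ ((v + l) C v)
fromℕ-prefixes v w l l≡ = sym (/-*-fromℕ (suc w) l ((v + l) C v) (prefixes (suc v) l) (prefixes-closed v w l≡))

-- The ballot number has slack `t`. The tail is a multiset of size `x` from `m` values, and `top`
-- identifies its binomial through `m - 1 + x = n - t - 2`.
plainTerm≡a : ∀ {n t m} → 1 ≤ m → m ≤ n ∸ t ∸ 1 → fromℕ (plainTerm n t m) ≡ a n t m
plainTerm≡a {n} {t} {m@(suc μ)} 1≤m m≤ = begin
  fromℕ (prefixes (suc m) (m + t) * weaklyDecreasings m x)
    ≡⟨ fromℕ-* (prefixes (suc m) (m + t)) (weaklyDecreasings m x) ⟩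
  fromℕ (prefixes (suc m) (m + t)) ℚ.* fromℕ (weaklyDecreasings m x)
    ≡⟨ cong₂ ℚ._*_ (fromℕ-prefixes m t (m + t) refl)
         (cong fromℕ (trans (weaklyDecreasings-closed μ x) (cong (_C μ) (sym top)))) ⟩
  (pos (suc t) ℚ./ suc (m + t)) ℚ.* fromℕ ((m + (m + t)) C m) ℚ.* fromℕ ((n ∸ t ∸ 2) C μ)
    ≡⟨ cong₂ (λ p q → (pos p ℚ./ suc (m + t)) ℚ.* fromℕ (q C m) ℚ.* fromℕ ((n ∸ t ∸ 2) C μ))
         (+-comm 1 t) (double m t) ⟩
  a n t m ∎
  where
  open ≡-Reasoning
  x = n ∸ suc (m + t)
  double : ∀ m t → m + (m + t) ≡ 2 * m + t
  double = solve-∀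
  regroup : ∀ μ t x → suc (suc μ + t) + x ≡ t + 2 + (μ + x)
  regroup = solve-∀
  top : n ∸ t ∸ 2 ≡ μ + x
  top = begin
    n ∸ t ∸ 2                       ≡⟨ ∸-+-assoc n t 2 ⟩
    n ∸ (t + 2)                     ≡⟨ cong (_∸ (t + 2)) (sym (m+[n∸m]≡n (plain-size {t = t} 1≤m m≤))) ⟩
    suc (m + t) + x ∸ (t + 2)       ≡⟨ cong (_∸ (t + 2)) (regroup μ t x) ⟩
    t + 2 + (μ + x) ∸ (t + 2)       ≡⟨ m+n∸m≡n (t + 2) (μ + x) ⟩
    μ + x                           ∎

weaklyDecreasings-0 : ∀ {l} → 0 < l → weaklyDecreasings 0 l ≡ 0
weaklyDecreasings-0 {suc l} _ = refl

-- For `j = 0` the prefix `g` is all zeros and nothing fits below `j`, so `d` must be empty and only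
-- the largest `k` contributes. The factor `t + 1` counts the values of `s`.
markedCount-0 : ∀ {n t m} → 1 ≤ m → m ≤ n ∸ t ∸ 3 →
                markedCount n t m 0 ≡ (t + 1) * (2 ^ (n ∸ m ∸ t ∸ 2) ∸ 1)
markedCount-0 {n} {t} {m} 1≤m m≤ = begin
  markedCount n t m 0                          ≡⟨ ∑ℕ-cong 0 t inner ⟩
  ∑ℕ 0 t (λ _ → 2 ^ (n ∸ m ∸ t ∸ 2) ∸ 1)       ≡⟨ ∑ℕ-const t _ ⟩
  suc t * (2 ^ (n ∸ m ∸ t ∸ 2) ∸ 1)            ≡⟨ cong (_* (2 ^ (n ∸ m ∸ t ∸ 2) ∸ 1)) (+-comm 1 t) ⟩
  (t + 1) * (2 ^ (n ∸ m ∸ t ∸ 2) ∸ 1)          ∎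
  where
  open ≡-Reasoning
  K = n ∸ m ∸ t ∸ 3
  regroup : ∀ m t k → m + t + k + 3 ≡ m + t + 3 + k
  regroup = solve-∀
  remaining : ∀ k → n ∸ (m + t + k + 3) ≡ K ∸ k
  remaining k = begin
    n ∸ (m + t + k + 3)    ≡⟨ cong (n ∸_) (regroup m t k) ⟩
    n ∸ (m + t + 3 + k)    ≡⟨ sym (∸-+-assoc n (m + t + 3) k) ⟩
    n ∸ (m + t + 3) ∸ k    ≡⟨ cong (_∸ k) (sym (∸∸∸ n m t)) ⟩
    K ∸ k                  ∎
  K+1≡ : K + 1 ≡ n ∸ m ∸ t ∸ 2
  K+1≡ = begin
    n ∸ m ∸ t ∸ 3 + 1      ≡⟨ cong (_+ 1) (sym (∸-+-assoc (n ∸ m ∸ t) 2 1)) ⟩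
    n ∸ m ∸ t ∸ 2 ∸ 1 + 1  ≡⟨ m∸n+n≡m (m<n⇒0<n∸m 2<) ⟩
    n ∸ m ∸ t ∸ 2          ∎
    where
    -- Guarantees that subtracting 3 does not truncate, so that adding 1 back gives the exponent in
    -- `b`.
    2< : 2 < n ∸ m ∸ t
    2< = ≤-trans (m+n≤o⇒m≤o∸n 3 (≤-trans (≤-reflexive (shift m t)) (marked-size {n} {t} {m} {0} 1≤m m≤ z≤n)))
           (≤-reflexive (sym (∸-+-assoc n m t)))
      where
      shift : ∀ m t → 3 + (m + t) ≡ m + t + 0 + 3
      shift = solve-∀
  inner : ∀ s → ∑ℕ 0 K (markedTerm n t m 0 s) ≡ 2 ^ (n ∸ m ∸ t ∸ 2) ∸ 1
  inner s = begin
    ∑ℕ 0 K (markedTerm n t m 0 s)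
      ≡⟨ ∑ℕ-last K _ (λ {k} k<K → begin
           markedTerm n t m 0 s k
             ≡⟨ cong (λ l → (2 ^ (k + 1) ∸ 1) * (prefixes 1 (m + s) * l))
                  (trans (cong (weaklyDecreasings 0) (remaining k)) (weaklyDecreasings-0 (m<n⇒0<n∸m k<K))) ⟩
           (2 ^ (k + 1) ∸ 1) * (prefixes 1 (m + s) * 0)
             ≡⟨ trans (cong ((2 ^ (k + 1) ∸ 1) *_) (*-zeroʳ (prefixes 1 (m + s)))) (*-zeroʳ (2 ^ (k + 1) ∸ 1)) ⟩
           0 ∎) ⟩
    markedTerm n t m 0 s K
      ≡⟨ cong₂ (λ p q → (2 ^ (K + 1) ∸ 1) * (p * q)) (prefixes-1 (m + s))
           (cong (weaklyDecreasings 0) (trans (remaining K) (n∸n≡0 K))) ⟩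
    (2 ^ (K + 1) ∸ 1) * 1
      ≡⟨ trans (*-identityʳ _) (cong (λ e → 2 ^ e ∸ 1) K+1≡) ⟩
    2 ^ (n ∸ m ∸ t ∸ 2) ∸ 1 ∎

-- The ballot number for `g` has slack `m + s - j`, a true difference since `j ≤ m`. The binomial
-- for `d` has top `j - 1 + x`, which turns the 3 in `x` into the 4 of the formula.
markedTerm≡ : ∀ {n t m j s k} → 1 ≤ m → m ≤ n ∸ t ∸ 3 → 1 ≤ j → j ≤ m ∸ 1 → k ≤ n ∸ m ∸ t ∸ 3 →
  fromℕ (markedTerm n t m j s k) ≡
  fromℕ (2 ^ (k + 1) ∸ 1) ℚ.* (pos (m + s ∸ j + 1) ℚ./ suc (m + s)) ℚ.*
    fromℕ ((m + j + s) C j) ℚ.* fromℕ ((n + j ∸ (m + t + k + 4)) C (j ∸ 1))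
markedTerm≡ {n} {t} {m} {j@(suc ι)} {s} {k} 1≤m m≤ 1≤j j≤ k≤ = begin
  fromℕ (X * (G * D))
    ≡⟨ trans (fromℕ-* X (G * D)) (cong (fromℕ X ℚ.*_) (fromℕ-* G D)) ⟩
  fromℕ X ℚ.* (fromℕ G ℚ.* fromℕ D)
    ≡⟨ cong₂ (λ p q → fromℕ X ℚ.* (p ℚ.* q))
         (fromℕ-prefixes j (m + s ∸ j) (m + s) (sym (m+[n∸m]≡n (≤-trans j≤m (m≤m+n m s)))))
         (cong fromℕ (trans (weaklyDecreasings-closed ι x) (cong (_C ι) (sym top)))) ⟩
  fromℕ X ℚ.* ((pos (suc (m + s ∸ j)) ℚ./ suc (m + s)) ℚ.* fromℕ ((j + (m + s)) C j) ℚ.* Y)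
    ≡⟨ cong₂ (λ p q → fromℕ X ℚ.* ((pos p ℚ./ suc (m + s)) ℚ.* fromℕ (q C j) ℚ.* Y))
         (+-comm 1 (m + s ∸ j)) (swap j m s) ⟩
  fromℕ X ℚ.* (R ℚ.* Z ℚ.* Y)
    ≡⟨ sym (ℚ.*-assoc (fromℕ X) (R ℚ.* Z) Y) ⟩
  fromℕ X ℚ.* (R ℚ.* Z) ℚ.* Y
    ≡⟨ cong (ℚ._* Y) (sym (ℚ.*-assoc (fromℕ X) R Z)) ⟩
  fromℕ X ℚ.* R ℚ.* Z ℚ.* Y ∎
  where
  open ≡-Reasoning
  x = n ∸ (m + t + k + 3)
  X = 2 ^ (k + 1) ∸ 1
  G = prefixes (suc j) (m + s)
  D = weaklyDecreasings j x
  R = pos (m + s ∸ j + 1) ℚ./ suc (m + s)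
  Z = fromℕ ((m + j + s) C j)
  Y = fromℕ ((n + j ∸ (m + t + k + 4)) C ι)
  j≤m : j ≤ m
  j≤m = ≤-trans j≤ (m∸n≤m m 1)
  swap : ∀ j m s → j + (m + s) ≡ m + j + s
  swap = solve-∀
  regroup : ∀ m t k x ι → m + t + k + 3 + x + suc ι ≡ m + t + k + 4 + (ι + x)
  regroup = solve-∀
  top : n + j ∸ (m + t + k + 4) ≡ ι + x
  top = begin
    n + j ∸ (m + t + k + 4)
      ≡⟨ cong (λ p → p + j ∸ (m + t + k + 4)) (sym (m+[n∸m]≡n (marked-size {t = t} 1≤m m≤ k≤))) ⟩
    m + t + k + 3 + x + j ∸ (m + t + k + 4)        ≡⟨ cong (_∸ (m + t + k + 4)) (regroup m t k x ι) ⟩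
    m + t + k + 4 + (ι + x) ∸ (m + t + k + 4)      ≡⟨ m+n∸m≡n (m + t + k + 4) (ι + x) ⟩
    ι + x                                          ∎

markedCounts≡b : ∀ {n t m} → 1 ≤ m → m ≤ n ∸ t ∸ 3 → fromℕ (∑ℕ 0 (m ∸ 1) (markedCount n t m)) ≡ b n t m
markedCounts≡b {n} {t} {m} 1≤m m≤ = begin
  fromℕ (∑ℕ 0 (m ∸ 1) (markedCount n t m))
    ≡⟨ cong fromℕ (∑ℕ-first (m ∸ 1) (markedCount n t m)) ⟩
  fromℕ (markedCount n t m 0 + ∑ℕ 1 (m ∸ 1) (markedCount n t m))
    ≡⟨ fromℕ-+ (markedCount n t m 0) _ ⟩
  fromℕ (markedCount n t m 0) ℚ.+ fromℕ (∑ℕ 1 (m ∸ 1) (markedCount n t m))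
    ≡⟨ cong₂ ℚ._+_ (cong fromℕ (markedCount-0 1≤m m≤))
         (fromℕ-∑ 1 (m ∸ 1) {markedCount n t m} λ {j} 1≤j j≤ →
          fromℕ-∑ 0 t {λ s → ∑ℕ 0 (n ∸ m ∸ t ∸ 3) (markedTerm n t m j s)} λ {s} _ _ →
          fromℕ-∑ 0 (n ∸ m ∸ t ∸ 3) {markedTerm n t m j s} λ _ k≤ → markedTerm≡ 1≤m m≤ 1≤j j≤ k≤) ⟩
  b n t m ∎
  where open ≡-Reasoning

corollary5p13 : (n t : ℕ) → 2 ≤ n → t ≤ n ∸ 2 →
    ∃[ N ] (HasCardinality (AvoiderOfRank n t) N ×
    fromℕ N ≡ (∑[ 1 ≤ m ≤ n ∸ t ∸ 1 ] a n t m) ℚ.+ (∑[ 1 ≤ m ≤ n ∸ t ∸ 3 ] b n t m))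
corollary5p13 n t 2≤n t≤n-2 =
  _ , card-vectors (card-listAvoider (≤∸⇒+≤ 2≤n t≤n-2)) ,
  trans (fromℕ-+ (∑ℕ 1 (n ∸ t ∸ 1) (plainTerm n t)) _)
    (cong₂ ℚ._+_ (fromℕ-∑ 1 (n ∸ t ∸ 1) {plainTerm n t} plainTerm≡a)
                 (fromℕ-∑ 1 (n ∸ t ∸ 3) {λ m → ∑ℕ 0 (m ∸ 1) (markedCount n t m)} markedCounts≡b))
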